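{- For any triangle-free graph $G$, $\beta(G)\leq \frac{27}{1024}$.
   Context: All graphs are finite and simple. For a graph $G$ with $n\geq 1$ vertices, a half in $G$ is a function $\mu: V(G)\to[0,1]$ such that $\sum_{v\in V(G)}\mu(v)=n/2$. Put $\beta(G,\mu)=\frac1{n^2}\sum_{\{u,v\}\in E(G)}\mu(u)\mu(v)$ (each edge is counted once) and $\beta(G)=\min\{\beta(G,\mu): \mu \text{ is a half in } G\}$. -}

module Defs where

open import Algebra.Bundles.Raw using (RawMonoid)
import Algebra.Definitions.RawMonoid as RawMonoidDefs
open import Data.Bool using (if_then_else_)
open import Data.Fin using (Fin)
import Data.Fin.Properties as Fin
open import Data.Integer using (+_)
open import Data.Nat as ℕ using (ℕ; NonZero)
import Data.Nat.Properties as ℕ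
open import Data.Product using (∃-syntax; _×_; _,_; proj₁; proj₂)
open import Data.Rational as ℚ using (ℚ; 0ℚ; 1ℚ; ½; _/_; Positive)
import Data.Rational.Properties as ℚ
open import Data.Rational.Solver using (module +-*-Solver)
open import Data.Vec.Functional using (Vector)
open import Level using (0ℓ)
open import Relation.Binary.Core using (Rel)
open import Relation.Binary.Definitions using (Decidable; Symmetric; Irreflexive)
open import Relation.Binary.PropositionalEquality
  using (_≡_; refl; sym; trans; cong; cong₂; subst)
open import Relation.Nullary using (¬_; does; _×-dec_)

-- Real numbers: rational Cauchy sequences, identified by _≃_ below.  All
-- operations act pointwise on sequences.

Cauchy : (ℕ → ℚ) → Set
Cauchy s = ∀ ε → 0ℚ ℚ.< ε →
  ∃[ N ] (∀ i j → N ℕ.≤ i → N ℕ.≤ j → ℚ.∣ s i ℚ.- s j ∣ ℚ.< ε)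

record ℝ : Set where
  constructor mkℝ
  field
    seq    : ℕ → ℚ
    cauchy : Cauchy seq

open ℝ public

infix  4 _≃_ _≤_
infixl 6 _+_
infixl 7 _*_

_≃_ : Rel ℝ 0ℓ
x ≃ y = ∀ ε → 0ℚ ℚ.< ε →
  ∃[ N ] (∀ i → N ℕ.≤ i → ℚ.∣ seq x i ℚ.- seq y i ∣ ℚ.< ε)

_≤_ : Rel ℝ 0ℓ
x ≤ y = ∀ ε → 0ℚ ℚ.< ε →
  ∃[ N ] (∀ i → N ℕ.≤ i → seq x i ℚ.< seq y i ℚ.+ ε)

fromℚ : ℚ → ℝ
fromℚ q = mkℝ (λ _ → q) λ ε 0<ε →
  0 , λ _ _ _ _ → subst (ℚ._< ε) (sym (cong ℚ.∣_∣ (ℚ.+-inverseʳ q))) 0<ε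

private
  open +-*-Solver using (solve; _:+_; _:*_; _:-_; con; _:=_)

  abstract
    0<½* : ∀ {ε} → 0ℚ ℚ.< ε → 0ℚ ℚ.< ½ ℚ.* ε
    0<½* {ε} 0<ε = subst (ℚ._< ½ ℚ.* ε) (ℚ.*-zeroʳ ½) (ℚ.*-monoʳ-<-pos ½ 0<ε)

    halves : ∀ ε → ½ ℚ.* ε ℚ.+ ½ ℚ.* ε ≡ ε
    halves = solve 1 (λ ε → con ½ :* ε :+ con ½ :* ε := ε) refl

    +-cauchy : ∀ s t → Cauchy s → Cauchy t → Cauchy (λ i → s i ℚ.+ t i)
    +-cauchy s t cs ct ε 0<ε
      with cs (½ ℚ.* ε) (0<½* 0<ε) | ct (½ ℚ.* ε) (0<½* 0<ε)
    ... | M , p | N , q = M ℕ.⊔ N , λ i j M⊔N≤i M⊔N≤j → begin-strict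
        ℚ.∣ (s i ℚ.+ t i) ℚ.- (s j ℚ.+ t j) ∣
          ≡⟨ cong ℚ.∣_∣ (rearrange (s i) (t i) (s j) (t j)) ⟩
        ℚ.∣ (s i ℚ.- s j) ℚ.+ (t i ℚ.- t j) ∣
          ≤⟨ ℚ.∣p+q∣≤∣p∣+∣q∣ (s i ℚ.- s j) (t i ℚ.- t j) ⟩
        ℚ.∣ s i ℚ.- s j ∣ ℚ.+ ℚ.∣ t i ℚ.- t j ∣
          <⟨ ℚ.+-mono-< (p i j (ℕ.m⊔n≤o⇒m≤o M N M⊔N≤i) (ℕ.m⊔n≤o⇒m≤o M N M⊔N≤j))
                        (q i j (ℕ.m⊔n≤o⇒n≤o M N M⊔N≤i) (ℕ.m⊔n≤o⇒n≤o M N M⊔N≤j)) ⟩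
        ½ ℚ.* ε ℚ.+ ½ ℚ.* ε
          ≡⟨ halves ε ⟩
        ε ∎
      where
      open ℚ.≤-Reasoning
      rearrange : ∀ a b c d → (a ℚ.+ b) ℚ.- (c ℚ.+ d) ≡ (a ℚ.- c) ℚ.+ (b ℚ.- d)
      rearrange = solve 4 (λ a b c d → (a :+ b) :- (c :+ d) := (a :- c) :+ (b :- d)) refl

    bounded : ∀ s → Cauchy s →
      ∃[ N ] ∃[ B ] (0ℚ ℚ.< B × (∀ i → N ℕ.≤ i → ℚ.∣ s i ∣ ℚ.≤ B))
    bounded s cs with cs 1ℚ (ℚ.positive⁻¹ 1ℚ)
    ... | N , p = N , 1ℚ ℚ.+ ℚ.∣ s N ∣
        , ℚ.+-mono-<-≤ (ℚ.positive⁻¹ 1ℚ) (ℚ.0≤∣p∣ (s N))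
        , λ i N≤i → begin
          ℚ.∣ s i ∣
            ≡⟨ cong ℚ.∣_∣ (split (s i) (s N)) ⟩
          ℚ.∣ (s i ℚ.- s N) ℚ.+ s N ∣
            ≤⟨ ℚ.∣p+q∣≤∣p∣+∣q∣ (s i ℚ.- s N) (s N) ⟩
          ℚ.∣ s i ℚ.- s N ∣ ℚ.+ ℚ.∣ s N ∣
            ≤⟨ ℚ.+-monoˡ-≤ ℚ.∣ s N ∣ (ℚ.<⇒≤ (p i N N≤i ℕ.≤-refl)) ⟩
          1ℚ ℚ.+ ℚ.∣ s N ∣ ∎
      where
      open ℚ.≤-Reasoning
      split : ∀ a b → a ≡ (a ℚ.- b) ℚ.+ b
      split = solve 2 (λ a b → a := (a :- b) :+ b) refl

    -- B * (ε / B) = ε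
    shrink : ∀ B ε → 0ℚ ℚ.< B → 0ℚ ℚ.< ε → ∃[ δ ] (0ℚ ℚ.< δ × B ℚ.* δ ≡ ε)
    shrink B ε 0<B 0<ε = B⁻¹ ℚ.* ε
        , ℚ.positive⁻¹ _ {{ℚ.pos*pos⇒pos B⁻¹ {{B⁻¹>0}} ε {{ℚ.positive 0<ε}}}}
        , trans (sym (ℚ.*-assoc B B⁻¹ ε))
            (trans (cong (ℚ._* ε) (ℚ.*-inverseʳ B {{B≢0}})) (ℚ.*-identityˡ ε))
      where
      B>0 : Positive B
      B>0 = ℚ.positive 0<B
      B≢0 : ℚ.NonZero B
      B≢0 = ℚ.pos⇒nonZero B {{B>0}}
      B⁻¹ : ℚ
      B⁻¹ = (ℚ.1/ B) {{B≢0}}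
      B⁻¹>0 : Positive B⁻¹
      B⁻¹>0 = ℚ.1/pos⇒pos B {{B>0}}

    ∣*∣-bound : ∀ a b {B δ} → 0ℚ ℚ.< B → ℚ.∣ a ∣ ℚ.≤ B → ℚ.∣ b ∣ ℚ.< δ →
      ℚ.∣ a ℚ.* b ∣ ℚ.< B ℚ.* δ
    ∣*∣-bound a b {B} {δ} 0<B ∣a∣≤B ∣b∣<δ = begin-strict
        ℚ.∣ a ℚ.* b ∣       ≡⟨ ℚ.∣p*q∣≡∣p∣*∣q∣ a b ⟩
        ℚ.∣ a ∣ ℚ.* ℚ.∣ b ∣ ≤⟨ ℚ.*-monoʳ-≤-nonNeg ℚ.∣ b ∣ {{ℚ.∣-∣-nonNeg b}} ∣a∣≤B ⟩
        B ℚ.* ℚ.∣ b ∣       <⟨ ℚ.*-monoʳ-<-pos B {{ℚ.positive 0<B}} ∣b∣<δ ⟩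
        B ℚ.* δ             ∎
      where open ℚ.≤-Reasoning

    *-close : ∀ a b c d {A B δ η ε} → 0ℚ ℚ.< A → 0ℚ ℚ.< B →
      ℚ.∣ a ∣ ℚ.≤ A → ℚ.∣ d ∣ ℚ.≤ B → ℚ.∣ a ℚ.- c ∣ ℚ.< δ → ℚ.∣ b ℚ.- d ∣ ℚ.< η →
      B ℚ.* δ ≡ ½ ℚ.* ε → A ℚ.* η ≡ ½ ℚ.* ε →
      ℚ.∣ a ℚ.* b ℚ.- c ℚ.* d ∣ ℚ.< ε
    *-close a b c d {A} {B} {δ} {η} {ε} 0<A 0<B ∣a∣≤A ∣d∣≤B a~c b~d Bδ≡ Aη≡ =
      begin-strict
        ℚ.∣ a ℚ.* b ℚ.- c ℚ.* d ∣
          ≡⟨ cong ℚ.∣_∣ (rearrange a b c d) ⟩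
        ℚ.∣ d ℚ.* (a ℚ.- c) ℚ.+ a ℚ.* (b ℚ.- d) ∣
          ≤⟨ ℚ.∣p+q∣≤∣p∣+∣q∣ (d ℚ.* (a ℚ.- c)) (a ℚ.* (b ℚ.- d)) ⟩
        ℚ.∣ d ℚ.* (a ℚ.- c) ∣ ℚ.+ ℚ.∣ a ℚ.* (b ℚ.- d) ∣
          <⟨ ℚ.+-mono-< (∣*∣-bound d (a ℚ.- c) 0<B ∣d∣≤B a~c)
                        (∣*∣-bound a (b ℚ.- d) 0<A ∣a∣≤A b~d) ⟩
        B ℚ.* δ ℚ.+ A ℚ.* η
          ≡⟨ cong₂ ℚ._+_ Bδ≡ Aη≡ ⟩
        ½ ℚ.* ε ℚ.+ ½ ℚ.* ε
          ≡⟨ halves ε ⟩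
        ε ∎
      where
      open ℚ.≤-Reasoning
      rearrange : ∀ a b c d →
        a ℚ.* b ℚ.- c ℚ.* d ≡ d ℚ.* (a ℚ.- c) ℚ.+ a ℚ.* (b ℚ.- d)
      rearrange = solve 4 (λ a b c d →
        a :* b :- c :* d := d :* (a :- c) :+ a :* (b :- d)) refl

    *-cauchy : ∀ s t → Cauchy s → Cauchy t → Cauchy (λ i → s i ℚ.* t i)
    *-cauchy s t cs ct ε 0<ε =
      let K , A , 0<A , s≤A = bounded s cs
          L , B , 0<B , t≤B = bounded t ct
          δ , 0<δ , Bδ≡ = shrink B (½ ℚ.* ε) 0<B (0<½* 0<ε)
          η , 0<η , Aη≡ = shrink A (½ ℚ.* ε) 0<A (0<½* 0<ε)
          M , p = cs δ 0<δ
          N , q = ct η 0<η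
      in (K ℕ.⊔ L) ℕ.⊔ (M ℕ.⊔ N) , λ i j ≤i ≤j →
        let K⊔L≤i = ℕ.m⊔n≤o⇒m≤o (K ℕ.⊔ L) (M ℕ.⊔ N) ≤i
            K⊔L≤j = ℕ.m⊔n≤o⇒m≤o (K ℕ.⊔ L) (M ℕ.⊔ N) ≤j
            M⊔N≤i = ℕ.m⊔n≤o⇒n≤o (K ℕ.⊔ L) (M ℕ.⊔ N) ≤i
            M⊔N≤j = ℕ.m⊔n≤o⇒n≤o (K ℕ.⊔ L) (M ℕ.⊔ N) ≤j
        in *-close (s i) (t i) (s j) (t j) 0<A 0<B
             (s≤A i (ℕ.m⊔n≤o⇒m≤o K L K⊔L≤i)) (t≤B j (ℕ.m⊔n≤o⇒n≤o K L K⊔L≤j))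
             (p i j (ℕ.m⊔n≤o⇒m≤o M N M⊔N≤i) (ℕ.m⊔n≤o⇒m≤o M N M⊔N≤j))
             (q i j (ℕ.m⊔n≤o⇒n≤o M N M⊔N≤i) (ℕ.m⊔n≤o⇒n≤o M N M⊔N≤j))
             Bδ≡ Aη≡

_+_ : ℝ → ℝ → ℝ
x + y = mkℝ (λ i → seq x i ℚ.+ seq y i)
            (+-cauchy (seq x) (seq y) (cauchy x) (cauchy y))

_*_ : ℝ → ℝ → ℝ
x * y = mkℝ (λ i → seq x i ℚ.* seq y i)
            (*-cauchy (seq x) (seq y) (cauchy x) (cauchy y))

+-rawMonoid : RawMonoid 0ℓ 0ℓ
+-rawMonoid = record { Carrier = ℝ ; _≈_ = _≃_ ; _∙_ = _+_ ; ε = fromℚ 0ℚ }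

open RawMonoidDefs +-rawMonoid public using (sum)

-- Finite simple graphs, with vertex set Fin n.

record Graph (n : ℕ) : Set₁ where
  field
    Adj    : Rel (Fin n) 0ℓ
    adj?   : Decidable Adj
    symm   : Symmetric Adj
    irrefl : Irreflexive _≡_ Adj

open Graph public

TriangleFree : ∀ {n} → Graph n → Set
TriangleFree G = ∀ u v w → ¬ (Adj G u v × Adj G v w × Adj G u w)

record IsHalf {n : ℕ} (μ : Vector ℝ n) : Set where
  field
    nonneg : ∀ v → fromℚ 0ℚ ≤ μ v
    ≤one   : ∀ v → μ v ≤ fromℚ 1ℚ
    total  : sum μ ≃ fromℚ (+ n / 2)

-- An edge {u,v} is listed only as the ordered pair with u < v, so that it is
-- counted once.
edgeSum : ∀ {n} → Graph n → Vector ℝ n → ℝ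
edgeSum G μ = sum λ u → sum λ v →
  if does (u Fin.<? v ×-dec adj? G u v) then μ u * μ v else fromℚ 0ℚ

βAt : ∀ {n} .{{_ : NonZero n}} → Graph n → Vector ℝ n → ℝ
βAt {n} G μ = fromℚ ((+ 1 / (n ℕ.* n)) {{ℕ.m*n≢0 n n}}) * edgeSum G μ

-- b is the minimum of βAt G over all halves, i.e. b = β(G).  A relation rather
-- than a function, because the existence of the minimum is itself a theorem.
record Isβ {n : ℕ} .{{_ : NonZero n}} (G : Graph n) (b : ℝ) : Set where
  field
    attained : ∃[ μ ] (IsHalf μ × βAt G μ ≃ b)
    minimal  : ∀ μ → IsHalf μ → b ≤ βAt G μ

{-# OPTIONS --safe #-}

module Submission where

-- Existence of β.  Moving weight between two vertices changes Σ μ(u) μ(v) concavely, so any half can be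
-- rounded, without increasing the sum, to one with at most one value outside {0, 1}; there are
-- finitely many of these.  Real halves are approximated by rational weights.
--
-- Upper bound.  Suppose β(G) > 27/1024.  After rescaling, every ν : V → [0, M] with n M ≤ 2 Σ ν satisfies
--   (∗)  27 (Σ ν)² ≤ 128 Σ_{u,v} a_uv ν_u ν_v.
-- For non-adjacent x, y put d = deg x, h = n - 2d, r = |N(y) ∖ N(x)|, and take ν = α on V ∖ N(x), lowered
-- by β on N(y) ∖ N(x).  The choices (1, 0), (1, 1) and (2r, h) of (α, β) in (∗) combine to an inequality
-- T(x, y) ≥ 0 (removal-inequality), where T is a sum over quadruples of vertices.  Hence Σ T(x, y) over
-- the non-adjacent pairs is a nonnegative sum over 6-tuples, and remains so after adding suitable squares.
-- But the summand, averaged over the permutations of the tuple, is negative for each of the triangle-free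
-- adjacency patterns on six positions, as a finite computation shows.

open import Algebra.Bundles using (CommutativeRing)
open import Data.Bool using (Bool; true; false; not; _∧_; _∨_; if_then_else_)
open import Data.Bool.Properties using (∧-conicalˡ; ∧-conicalʳ)
open import Data.Empty using (⊥; ⊥-elim)
open import Data.Fin as Fin using (Fin; toℕ; fromℕ<)
import Data.Fin.Properties as Fin
open import Data.Integer as ℤ using (ℤ)
import Data.Integer.Properties as ℤ
open import Data.List using (List; []; _∷_; drop; filter; allFin; cartesianProduct; cartesianProductWith)
open import Data.List.Membership.Propositional using (_∈_)
open import Data.List.Membership.Propositional.Properties
  using (∈-cartesianProductWith⁺; ∈-cartesianProduct⁺; ∈-filter⁺; ∈-allFin)
import Data.List.Relation.Unary.All as All
import Data.List.Relation.Unary.All.Properties as All using (all-filter)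
open import Data.List.Relation.Unary.Any using (here; there)
open import Data.Nat as ℕ using (ℕ; zero; suc; NonZero; z≤n; s≤s)
import Data.Nat.Coprimality as Coprime
import Data.Nat.Properties as ℕ
open import Data.Product using (_,_; _×_; proj₁; proj₂; ∃-syntax)
open import Data.Rational as ℚ using (ℚ)
import Data.Rational.Properties as ℚ
import Data.Rational.Unnormalised as ℚᵘ
import Data.Rational.Unnormalised.Properties as ℚᵘ
open import Data.Sum using (_⊎_; inj₁; inj₂; swap)
open import Data.Vec using (Vec; []; _∷_; lookup; tabulate)
import Data.Vec.Properties as Vec
open import Function using (_∘_)
open import Relation.Binary.Bundles using (DecTotalOrder)
open import Relation.Binary.Definitions using (Tri; tri<; tri≈; tri>)
open import Relation.Binary.PropositionalEquality
open import Relation.Nullary using (Dec; yes; no; does; _×-dec_)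
open import Relation.Nullary.Decidable using (map′; dec-true; dec-false)
open ≡-Reasoning

-- Put `τ = 2r - h`. The weighting (1, 1) is admissible in (∗) only for `τ ≤ 0` and (2r, h) only for
-- `τ ≥ 0`, but a case distinction depending on (x, y) cannot be summed over the pairs. The way out
-- is one polynomial that covers both cases. Let `K` and `B` be 4 times the slack of (∗) at (1, 0)
-- and at (1, 1), plus 27 times the square of the excess `2 Σ ν - n`, which is `h` and `h - 2r`
-- respectively. At (2r, h) the constraint `n M ≤ 2 Σ ν` is an equality, and for `r > 0` the slack
-- there is, up to a positive factor, `h B + τ K`. So `K ≥ 0` and `h B + max(τ, 0) K ≥ 0` hold in
-- either case. Since `28 n τ ≤ (7τ + n)²`, with equality at `τ = n/7`, and `7τ + n = 2Z` for
-- `Z = 7(r + d) - 3n`, this weakens to `7 n h B + K Z² ≥ 0`, which is T. Each term of T is a sum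
-- over four vertices; with x and y this makes the six positions.

module Counting where

  -- The certificate: an integer function of the adjacency pattern of six positions.

  open import Data.Integer
    using (ℤ; +_; -[1+_]; -_; _+_; _*_; _-_; 0ℤ; 1ℤ; _≤_; _<_; positive; nonNegative; +≤+; +<+; -<+)
  open import Data.Integer.Solver using (module +-*-Solver)
  open import Algebra.Properties.Semiring.Sum ℤ.+-*-semiring
    using (sum; sum-cong-≗; ∑-distrib-+; ∑-comm; *-distribˡ-sum; *-distribʳ-sum)
  open +-*-Solver using (solve; _:=_; _:+_; _:*_; _:-_; con)

  -- Tabulating a function in a trie makes the evaluator compute each of its values at most once.
  data Trie (A : Set) : ℕ → Set where
    leaf : A → Trie A 0
    node : ∀ {n} → Trie A n → Trie A n → Trie A (suc n)

  lookupᵗ : ∀ {A n} → Trie A n → Vec Bool n → A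
  lookupᵗ (leaf a)   []          = a
  lookupᵗ (node l r) (false ∷ p) = lookupᵗ l p
  lookupᵗ (node l r) (true  ∷ p) = lookupᵗ r p

  tabulateᵗ : ∀ {A} n → (Vec Bool n → A) → Trie A n
  tabulateᵗ zero    f = leaf (f [])
  tabulateᵗ (suc n) f =
    node (tabulateᵗ n (λ p → f (false ∷ p))) (tabulateᵗ n (λ p → f (true ∷ p)))

  lookup∘tabulate : ∀ {A n} (f : Vec Bool n → A) p → lookupᵗ (tabulateᵗ n f) p ≡ f p
  lookup∘tabulate f []          = refl
  lookup∘tabulate f (false ∷ p) = lookup∘tabulate (λ q → f (false ∷ q)) p
  lookup∘tabulate f (true  ∷ p) = lookup∘tabulate (λ q → f (true ∷ q)) p

  -- Entry number p of the table, p being read as a binary number, most significant bit first.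
  coeff : ∀ {n} → List ℤ → Vec Bool n → ℤ
  coeff []       []            = 0ℤ
  coeff (c ∷ cs) []            = c
  coeff cs       (_∷_ {n} b p) = coeff (if b then drop (2 ℕ.^ n) cs else cs) p

  -- An entry of the Gram matrix of the rows. When `p` and `q` range independently over the
  -- extensions of the same roots, the sum of the entries is a sum of squares, one for each row.
  sumSq : ∀ {n} → List (List ℤ) → Vec Bool n → Vec Bool n → ℤ
  sumSq []       p q = 0ℤ
  sumSq (c ∷ cs) p q = coeff c p * coeff c q + sumSq cs p q

  bit : Bool → ℤ
  bit b = if b then 1ℤ else 0ℤ

  -- The adjacencies of six positions, in the order 01, 02, …, 05, 12, …, 45.
  Pattern : Set
  Pattern = Vec Bool 15

  -- Factors of the sums of squares: a rounded numerical solution of the flag-algebra semidefinite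
  -- program.  The bits of an index are the adjacencies listed in the cert functions below.
  nonedgeSq : List (List ℤ)
  nonedgeSq =
    (- + 3843 ∷ + 6008 ∷ + 787 ∷ + 7131 ∷ + 787 ∷ + 7131 ∷ + 1222 ∷ + 3924 ∷
     + 787 ∷ + 7131 ∷ - + 5181 ∷ + 0 ∷ - + 2405 ∷ - + 308 ∷ - + 5906 ∷ + 0 ∷
     + 787 ∷ + 7131 ∷ - + 2405 ∷ - + 308 ∷ - + 5181 ∷ + 0 ∷ - + 5906 ∷ + 0 ∷
     + 1222 ∷ + 3924 ∷ - + 5906 ∷ + 0 ∷ - + 5906 ∷ + 0 ∷ - + 3684 ∷ + 0 ∷ []) ∷
    (- + 2284 ∷ + 3560 ∷ + 564 ∷ - + 231 ∷ + 564 ∷ - + 231 ∷ + 733 ∷ + 2208 ∷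
     + 564 ∷ - + 231 ∷ + 5724 ∷ + 0 ∷ - + 503 ∷ - + 5873 ∷ - + 1007 ∷ + 0 ∷
     + 564 ∷ - + 231 ∷ - + 503 ∷ - + 5873 ∷ + 5724 ∷ + 0 ∷ - + 1007 ∷ + 0 ∷
     + 733 ∷ + 2208 ∷ - + 1007 ∷ + 0 ∷ - + 1007 ∷ + 0 ∷ - + 1926 ∷ + 0 ∷ []) ∷
    (+ 1114 ∷ - + 2376 ∷ + 408 ∷ - + 1658 ∷ + 408 ∷ - + 1658 ∷ - + 67 ∷
     + 1836 ∷ + 408 ∷ - + 1658 ∷ + 125 ∷ + 0 ∷ + 4374 ∷ + 1286 ∷ - + 2469 ∷
     + 0 ∷ + 408 ∷ - + 1658 ∷ + 4374 ∷ + 1286 ∷ + 125 ∷ + 0 ∷ - + 2469 ∷ + 0 ∷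
     - + 67 ∷ + 1836 ∷ - + 2469 ∷ + 0 ∷ - + 2469 ∷ + 0 ∷ - + 4752 ∷ + 0 ∷ []) ∷ []

  -- The second row changes sign when the two roots are exchanged, the others are invariant: the
  -- symmetry of the root edge splits the semidefinite matrix into two blocks. The antisymmetric
  -- rows of the tables below arise in the same way.
  edgeSq : List (List ℤ)
  edgeSq =
    (+ 526 ∷ - + 2311 ∷ - + 1009 ∷ + 87 ∷ - + 1009 ∷ + 87 ∷ + 0 ∷ + 0 ∷
     - + 1009 ∷ + 87 ∷ - + 4400 ∷ + 0 ∷ + 6974 ∷ + 4696 ∷ + 0 ∷ + 0 ∷
     - + 1009 ∷ + 87 ∷ + 6974 ∷ + 4696 ∷ - + 4400 ∷ + 0 ∷ + 0 ∷ + 0 ∷ + 0 ∷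
     + 0 ∷ + 0 ∷ + 0 ∷ + 0 ∷ + 0 ∷ + 0 ∷ + 0 ∷ []) ∷
    (+ 0 ∷ + 0 ∷ + 3761 ∷ + 289 ∷ - + 3761 ∷ - + 289 ∷ + 0 ∷ + 0 ∷ + 3761 ∷
     + 289 ∷ + 2257 ∷ + 0 ∷ + 0 ∷ + 0 ∷ + 0 ∷ + 0 ∷ - + 3761 ∷ - + 289 ∷ + 0 ∷
     + 0 ∷ - + 2257 ∷ + 0 ∷ + 0 ∷ + 0 ∷ + 0 ∷ + 0 ∷ + 0 ∷ + 0 ∷ + 0 ∷ + 0 ∷
     + 0 ∷ + 0 ∷ []) ∷
    (- + 1666 ∷ + 1724 ∷ + 1740 ∷ + 147 ∷ + 1740 ∷ + 147 ∷ + 0 ∷ + 0 ∷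
     + 1740 ∷ + 147 ∷ - + 1683 ∷ + 0 ∷ - + 1724 ∷ + 1179 ∷ + 0 ∷ + 0 ∷
     + 1740 ∷ + 147 ∷ - + 1724 ∷ + 1179 ∷ - + 1683 ∷ + 0 ∷ + 0 ∷ + 0 ∷ + 0 ∷
     + 0 ∷ + 0 ∷ + 0 ∷ + 0 ∷ + 0 ∷ + 0 ∷ + 0 ∷ []) ∷
    (+ 1087 ∷ + 1693 ∷ - + 457 ∷ - + 306 ∷ - + 457 ∷ - + 306 ∷ + 0 ∷ + 0 ∷
     - + 457 ∷ - + 306 ∷ - + 103 ∷ + 0 ∷ + 46 ∷ + 270 ∷ + 0 ∷ + 0 ∷ - + 457 ∷
     - + 306 ∷ + 46 ∷ + 270 ∷ - + 103 ∷ + 0 ∷ + 0 ∷ + 0 ∷ + 0 ∷ + 0 ∷ + 0 ∷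
     + 0 ∷ + 0 ∷ + 0 ∷ + 0 ∷ + 0 ∷ []) ∷ []

  oneEdgeSq : List (List ℤ)
  oneEdgeSq =
    (+ 0 ∷ + 0 ∷ + 0 ∷ + 0 ∷ - + 7292 ∷ - + 10526 ∷ - + 10526 ∷ - + 3133 ∷
     + 7292 ∷ + 10526 ∷ + 10526 ∷ + 3133 ∷ + 0 ∷ + 0 ∷ + 0 ∷ + 0 ∷ []) ∷
    (+ 0 ∷ + 11604 ∷ - + 11604 ∷ + 0 ∷ + 0 ∷ + 3745 ∷ - + 3745 ∷ + 0 ∷ + 0 ∷
     + 3745 ∷ - + 3745 ∷ + 0 ∷ + 0 ∷ + 0 ∷ + 0 ∷ + 0 ∷ []) ∷
    (- + 931 ∷ - + 5023 ∷ - + 5023 ∷ + 2849 ∷ - + 605 ∷ + 3443 ∷ + 3443 ∷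
     + 1377 ∷ - + 605 ∷ + 3443 ∷ + 3443 ∷ + 1377 ∷ + 0 ∷ + 0 ∷ + 0 ∷ + 0 ∷ []) ∷
    (+ 0 ∷ + 0 ∷ + 0 ∷ + 0 ∷ + 2475 ∷ - + 1275 ∷ - + 1275 ∷ + 2805 ∷
     - + 2475 ∷ + 1275 ∷ + 1275 ∷ - + 2805 ∷ + 0 ∷ + 0 ∷ + 0 ∷ + 0 ∷ []) ∷
    (- + 905 ∷ + 136 ∷ + 136 ∷ - + 379 ∷ + 716 ∷ + 165 ∷ + 165 ∷ + 75 ∷
     + 716 ∷ + 165 ∷ + 165 ∷ + 75 ∷ + 0 ∷ + 0 ∷ + 0 ∷ + 0 ∷ []) ∷ []

  cherrySq : List (List ℤ)
  cherrySq =
    (- + 4044 ∷ + 8343 ∷ + 2537 ∷ - + 4376 ∷ + 2537 ∷ - + 4376 ∷ - + 2479 ∷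
     + 3095 ∷ + 3107 ∷ + 833 ∷ + 0 ∷ + 0 ∷ + 0 ∷ + 0 ∷ + 0 ∷ + 0 ∷ []) ∷
    (+ 0 ∷ + 0 ∷ + 2709 ∷ - + 2725 ∷ - + 2709 ∷ + 2725 ∷ + 0 ∷ + 0 ∷ + 0 ∷
     + 0 ∷ + 0 ∷ + 0 ∷ + 0 ∷ + 0 ∷ + 0 ∷ + 0 ∷ []) ∷ []

  triangle : Pattern → Bool
  triangle (a01 ∷ a02 ∷ a03 ∷ a04 ∷ a05 ∷ a12 ∷ a13 ∷ a14 ∷ a15 ∷ a23 ∷ a24 ∷ a25 ∷ a34 ∷ a35 ∷ a45 ∷ []) =
      (a01 ∧ a02 ∧ a12) ∨
      (a01 ∧ a03 ∧ a13) ∨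
      (a01 ∧ a04 ∧ a14) ∨
      (a01 ∧ a05 ∧ a15) ∨
      (a02 ∧ a03 ∧ a23) ∨
      (a02 ∧ a04 ∧ a24) ∨
      (a02 ∧ a05 ∧ a25) ∨
      (a03 ∧ a04 ∧ a34) ∨
      (a03 ∧ a05 ∧ a35) ∨
      (a04 ∧ a05 ∧ a45) ∨
      (a12 ∧ a13 ∧ a23) ∨
      (a12 ∧ a14 ∧ a24) ∨
      (a12 ∧ a15 ∧ a25) ∨
      (a13 ∧ a14 ∧ a34) ∨
      (a13 ∧ a15 ∧ a35) ∨
      (a14 ∧ a15 ∧ a45) ∨
      (a23 ∧ a24 ∧ a34) ∨
      (a23 ∧ a25 ∧ a35) ∨
      (a24 ∧ a25 ∧ a45) ∨
      (a34 ∧ a35 ∧ a45)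

  -- `swap0` to `swap4` are the actions on patterns of the five adjacent transpositions, which
  -- generate all relabellings of the positions.
  swap0 : Pattern → Pattern
  swap0 (a01 ∷ a02 ∷ a03 ∷ a04 ∷ a05 ∷ a12 ∷ a13 ∷ a14 ∷ a15 ∷ a23 ∷ a24 ∷ a25 ∷ a34 ∷ a35 ∷ a45 ∷ []) =
    a01 ∷ a12 ∷ a13 ∷ a14 ∷ a15 ∷ a02 ∷ a03 ∷ a04 ∷ a05 ∷ a23 ∷ a24 ∷ a25 ∷ a34 ∷ a35 ∷ a45 ∷ []

  swap1 : Pattern → Pattern
  swap1 (a01 ∷ a02 ∷ a03 ∷ a04 ∷ a05 ∷ a12 ∷ a13 ∷ a14 ∷ a15 ∷ a23 ∷ a24 ∷ a25 ∷ a34 ∷ a35 ∷ a45 ∷ []) =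
    a02 ∷ a01 ∷ a03 ∷ a04 ∷ a05 ∷ a12 ∷ a23 ∷ a24 ∷ a25 ∷ a13 ∷ a14 ∷ a15 ∷ a34 ∷ a35 ∷ a45 ∷ []

  swap2 : Pattern → Pattern
  swap2 (a01 ∷ a02 ∷ a03 ∷ a04 ∷ a05 ∷ a12 ∷ a13 ∷ a14 ∷ a15 ∷ a23 ∷ a24 ∷ a25 ∷ a34 ∷ a35 ∷ a45 ∷ []) =
    a01 ∷ a03 ∷ a02 ∷ a04 ∷ a05 ∷ a13 ∷ a12 ∷ a14 ∷ a15 ∷ a23 ∷ a34 ∷ a35 ∷ a24 ∷ a25 ∷ a45 ∷ []

  swap3 : Pattern → Pattern
  swap3 (a01 ∷ a02 ∷ a03 ∷ a04 ∷ a05 ∷ a12 ∷ a13 ∷ a14 ∷ a15 ∷ a23 ∷ a24 ∷ a25 ∷ a34 ∷ a35 ∷ a45 ∷ []) =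
    a01 ∷ a02 ∷ a04 ∷ a03 ∷ a05 ∷ a12 ∷ a14 ∷ a13 ∷ a15 ∷ a24 ∷ a23 ∷ a25 ∷ a34 ∷ a45 ∷ a35 ∷ []

  swap4 : Pattern → Pattern
  swap4 (a01 ∷ a02 ∷ a03 ∷ a04 ∷ a05 ∷ a12 ∷ a13 ∷ a14 ∷ a15 ∷ a23 ∷ a24 ∷ a25 ∷ a34 ∷ a35 ∷ a45 ∷ []) =
    a01 ∷ a02 ∷ a03 ∷ a05 ∷ a04 ∷ a12 ∷ a13 ∷ a15 ∷ a14 ∷ a23 ∷ a25 ∷ a24 ∷ a35 ∷ a34 ∷ a45 ∷ []

  co-bit : Bool → ℤ
  co-bit a = 1ℤ - bit a

  -- In the notation of removal-inequality, H sums to h, R to r, L to Z, EW to e and RW to ρ when x and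
  -- y are fixed; a₀ stands for adjacency to x and a₁ for adjacency to y.
  H : Bool → ℤ
  H a = 1ℤ - + 2 * bit a

  R : Bool → Bool → ℤ
  R a₀ a₁ = bit a₁ * co-bit a₀

  L : Bool → Bool → ℤ
  L a₀ a₁ = + 7 * (R a₀ a₁ + bit a₀) - + 3

  EW : Bool → Bool → Bool → ℤ
  EW a₀ a₀′ a = bit a * (co-bit a₀ * co-bit a₀′)

  RW : Bool → Bool → Bool → Bool → ℤ
  RW a₀ a₁ a₀′ a = bit a * (R a₀ a₁ * co-bit a₀′)

  -- The polynomial of removal-inequality for x, y at positions 0, 1, summed over positions 2 to 5.  Each
  -- term is a product of factors in {2,3}, {4} and {5}, so that its sum factors.
  certT : Pattern → ℤ
  certT (a01 ∷ a02 ∷ a03 ∷ a04 ∷ a05 ∷ a12 ∷ a13 ∷ a14 ∷ a15 ∷ a23 ∷ a24 ∷ a25 ∷ a34 ∷ a35 ∷ a45 ∷ []) =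
    -- The scale 2^14 brings T to the size of the squared table entries, so that rounding those to
    -- integers costs little. On the empty pattern T gives -1296 · 16384 = -21233664, and the
    -- squares give 3843² + 2284² + 1114² = 21226301.
    co-bit a01 * (+ 16384 *
      ((+ 512 * EW a02 a03 a23 - + 1024 * RW a02 a12 a03 a23 - + 27) * (+ 7 * H a04 * 1ℤ)
      + 1ℤ * (+ 7 * H a04 * (+ 108 * R a05 a15 - + 54 * H a05))
      + (+ 512 * EW a02 a03 a23 - + 27 - + 54 * H a02) * (L a04 a14 * L a05 a15)))

  -- Six positions allow two kinds of squares: two roots, each factor adding two further vertices (2
  -- + 2 + 2), or four roots, each factor adding one (4 + 1 + 1). The two-root squares are rooted at
  -- a non-edge and at an edge, the four-root squares at an edge with two isolated vertices and at a
  -- path of two edges with one isolated vertex.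
  certNonedge : Pattern → ℤ
  certNonedge (a01 ∷ a02 ∷ a03 ∷ a04 ∷ a05 ∷ a12 ∷ a13 ∷ a14 ∷ a15 ∷ a23 ∷ a24 ∷ a25 ∷ a34 ∷ a35 ∷ a45 ∷ []) =
    co-bit a01 * sumSq nonedgeSq (a02 ∷ a12 ∷ a03 ∷ a13 ∷ a23 ∷ []) (a04 ∷ a14 ∷ a05 ∷ a15 ∷ a45 ∷ [])

  certEdge : Pattern → ℤ
  certEdge (a01 ∷ a02 ∷ a03 ∷ a04 ∷ a05 ∷ a12 ∷ a13 ∷ a14 ∷ a15 ∷ a23 ∷ a24 ∷ a25 ∷ a34 ∷ a35 ∷ a45 ∷ []) =
    bit a01 * sumSq edgeSq (a02 ∷ a12 ∷ a03 ∷ a13 ∷ a23 ∷ []) (a04 ∷ a14 ∷ a05 ∷ a15 ∷ a45 ∷ [])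

  certOneEdge : Pattern → ℤ
  certOneEdge (a01 ∷ a02 ∷ a03 ∷ a04 ∷ a05 ∷ a12 ∷ a13 ∷ a14 ∷ a15 ∷ a23 ∷ a24 ∷ a25 ∷ a34 ∷ a35 ∷ a45 ∷ []) =
    bit (a01 ∧ not a02 ∧ not a03 ∧ not a12 ∧ not a13 ∧ not a23) *
      sumSq oneEdgeSq (a04 ∷ a14 ∷ a24 ∷ a34 ∷ []) (a05 ∷ a15 ∷ a25 ∷ a35 ∷ [])

  certCherry : Pattern → ℤ
  certCherry (a01 ∷ a02 ∷ a03 ∷ a04 ∷ a05 ∷ a12 ∷ a13 ∷ a14 ∷ a15 ∷ a23 ∷ a24 ∷ a25 ∷ a34 ∷ a35 ∷ a45 ∷ []) =
    bit (a01 ∧ a02 ∧ not a03 ∧ not a12 ∧ not a13 ∧ not a23) *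
      sumSq cherrySq (a04 ∷ a14 ∷ a24 ∷ a34 ∷ []) (a05 ∷ a15 ∷ a25 ∷ a35 ∷ [])

  cert : Pattern → ℤ
  cert p = certT p + (certNonedge p + (certEdge p + (certOneEdge p + certCherry p)))

  Table : Set
  Table = Trie ℤ 15

  -- coset g k sums g over coset representatives of S_k in S_(k+1), so that for k = 1, …, 5 in turn the
  -- sum over all permutations of the positions is built up.
  coset : (Pattern → ℤ) → ℕ → Pattern → ℤ
  coset g 0 p = g p
  coset g 1 p = g p + coset (λ q → g (swap0 q)) 0 p
  coset g 2 p = g p + coset (λ q → g (swap1 q)) 1 p
  coset g 3 p = g p + coset (λ q → g (swap2 q)) 2 p
  coset g 4 p = g p + coset (λ q → g (swap3 q)) 3 p
  coset g 5 p = g p + coset (λ q → g (swap4 q)) 4 p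
  coset g _ p = 0ℤ

  stage : ℕ → Table → Table
  stage k t = tabulateᵗ 15 (coset (lookupᵗ t) k)

  isNeg : ℤ → Bool
  isNeg (+ _) = false
  isNeg ℤ.-[1+ _ ] = true

  allLeaves : ∀ {n} → (Vec Bool n → ℤ → Bool) → Trie ℤ n → Bool
  allLeaves f (leaf a) = f [] a
  allLeaves f (node l r) = allLeaves (λ p → f (false ∷ p)) l ∧ allLeaves (λ p → f (true ∷ p)) r

  allLeaves-sound : ∀ {n} f (t : Trie ℤ n) → allLeaves f t ≡ true → ∀ p → f p (lookupᵗ t p) ≡ true
  allLeaves-sound f (leaf a)   eq []          = eq
  allLeaves-sound f (node l r) eq (false ∷ p) = allLeaves-sound (λ q → f (false ∷ q)) l (∧-conicalˡ _ _ eq) p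
  allLeaves-sound f (node l r) eq (true  ∷ p) = allLeaves-sound (λ q → f (true ∷ q)) r (∧-conicalʳ _ _ eq) p

  -- Going up the chain S_1 < S_2 < ... < S_6 and tabulating each stage takes 2 + 3 + 4 + 5 + 6 = 20
  -- lookups per pattern, where the sum over S_6 has 720 terms.
  symmetrize : Table → Table
  symmetrize t = stage 5 (stage 4 (stage 3 (stage 2 (stage 1 t))))

  certTable : Table
  certTable = tabulateᵗ 15 cert

  checked : allLeaves (λ p c → triangle p ∨ isNeg c) (symmetrize certTable) ≡ true
  checked = refl

  -- Finite sums of integers.

  0≤+ : ∀ {i j} → 0ℤ ≤ i → 0ℤ ≤ j → 0ℤ ≤ i + j
  0≤+ = ℤ.+-mono-≤

  0≤* : ∀ {i j} → 0ℤ ≤ i → 0ℤ ≤ j → 0ℤ ≤ i * j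
  0≤* {i} {j} 0≤i 0≤j = subst (_≤ i * j) (ℤ.*-zeroʳ i) (ℤ.*-monoˡ-≤-nonNeg i {{nonNegative 0≤i}} 0≤j)

  0≤i² : ∀ i → 0ℤ ≤ i * i
  0≤i² (+ n)    = 0≤* {+ n} (+≤+ z≤n) (+≤+ z≤n)
  0≤i² -[1+ n ] = +≤+ z≤n

  0≤bit : ∀ b → 0ℤ ≤ bit b
  0≤bit false = +≤+ z≤n
  0≤bit true  = +≤+ z≤n

  0≤co-bit : ∀ b → 0ℤ ≤ co-bit b
  0≤co-bit false = +≤+ z≤n
  0≤co-bit true  = +≤+ z≤n

  sum-nonneg : ∀ {n} (f : Fin n → ℤ) → (∀ i → 0ℤ ≤ f i) → 0ℤ ≤ sum f
  sum-nonneg {zero}  f 0≤f = ℤ.≤-refl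
  sum-nonneg {suc n} f 0≤f = 0≤+ (0≤f Fin.zero) (sum-nonneg (f ∘ Fin.suc) (0≤f ∘ Fin.suc))

  sum-neg : ∀ {n} .{{_ : NonZero n}} (f : Fin n → ℤ) → (∀ i → f i < 0ℤ) → sum f < 0ℤ
  sum-neg {suc zero}    f f<0 = ℤ.+-mono-<-≤ (f<0 Fin.zero) ℤ.≤-refl
  sum-neg {suc (suc n)} f f<0 = ℤ.+-mono-< (f<0 Fin.zero) (sum-neg (f ∘ Fin.suc) (f<0 ∘ Fin.suc))

  sum-const : ∀ n c → sum {n} (λ _ → c) ≡ + n * c
  sum-const zero    c = sym (ℤ.*-zeroˡ c)
  sum-const (suc n) c = trans (cong (_+_ c) (sum-const n c))
    (sym (ℤ.suc-* (+ n) c))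

  sum-- : ∀ {n} (f g : Fin n → ℤ) → sum (λ i → f i - g i) ≡ sum f - sum g
  sum-- f g = begin
    sum (λ i → f i - g i)              ≡⟨ sum-cong-≗ (λ i → cong (_+_ (f i)) (sym (ℤ.-1*i≡-i (g i)))) ⟩
    sum (λ i → f i + - 1ℤ * g i)       ≡⟨ ∑-distrib-+ f (λ i → - 1ℤ * g i) ⟩
    sum f + sum (λ i → - 1ℤ * g i)     ≡⟨ cong (_+_ (sum f)) (sym (*-distribˡ-sum (- 1ℤ) g)) ⟩
    sum f + - 1ℤ * sum g               ≡⟨ cong (_+_ (sum f)) (ℤ.-1*i≡-i (sum g)) ⟩
    sum f - sum g                      ∎

  sum₂ : ∀ {n} → (Fin n → Fin n → ℤ) → ℤ
  sum₂ f = sum λ i → sum λ j → f i j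

  module _ {n : ℕ} where
    private
      V₂ = Fin n → Fin n → ℤ

    sum₂-cong : {f g : V₂} → (∀ i j → f i j ≡ g i j) → sum₂ f ≡ sum₂ g
    sum₂-cong eq = sum-cong-≗ λ i → sum-cong-≗ (eq i)

    sum₂-+ : (f g : V₂) → sum₂ (λ i j → f i j + g i j) ≡ sum₂ f + sum₂ g
    sum₂-+ f g = trans (sum-cong-≗ λ i → ∑-distrib-+ (f i) (g i)) (∑-distrib-+ (sum ∘ f) (sum ∘ g))

    sum₂-- : (f g : V₂) → sum₂ (λ i j → f i j - g i j) ≡ sum₂ f - sum₂ g
    sum₂-- f g = trans (sum-cong-≗ λ i → sum-- (f i) (g i)) (sum-- (sum ∘ f) (sum ∘ g))

    sum₂-*ˡ : ∀ c (f : V₂) → sum₂ (λ i j → c * f i j) ≡ c * sum₂ f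
    sum₂-*ˡ c f = sym (trans (*-distribˡ-sum c (sum ∘ f)) (sum-cong-≗ λ i → *-distribˡ-sum c (f i)))

    sum₂-*ʳ : ∀ c (f : V₂) → sum₂ (λ i j → f i j * c) ≡ sum₂ f * c
    sum₂-*ʳ c f = sym (trans (*-distribʳ-sum c (sum ∘ f)) (sum-cong-≗ λ i → *-distribʳ-sum c (f i)))

    sum-prod : (f g : Fin n → ℤ) → sum₂ (λ i j → f i * g j) ≡ sum f * sum g
    sum-prod f g = sym (trans (*-distribʳ-sum (sum g) f) (sum-cong-≗ λ i → *-distribˡ-sum (f i) g))

    sum₂-prod : (f g : V₂) → sum₂ (λ i j → sum₂ λ k l → f i j * g k l) ≡ sum₂ f * sum₂ g
    sum₂-prod f g = trans (sum₂-cong λ i j → sum₂-*ˡ (f i j) g) (sum₂-*ʳ (sum₂ g) f)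

    sum₂-const : ∀ c → sum₂ {n} (λ _ _ → c) ≡ + n * (+ n * c)
    sum₂-const c = trans (sum-const n (sum {n} λ _ → c)) (cong (_*_ (+ n)) (sum-const n c))

    sum₂-zero : sum₂ {n} (λ _ _ → 0ℤ) ≡ 0ℤ
    sum₂-zero = trans (sum₂-const 0ℤ) (trans (cong (_*_ (+ n)) (ℤ.*-zeroʳ (+ n))) (ℤ.*-zeroʳ (+ n)))

    sum₂-nonneg : (f : V₂) → (∀ i j → 0ℤ ≤ f i j) → 0ℤ ≤ sum₂ f
    sum₂-nonneg f 0≤f = sum-nonneg _ λ i → sum-nonneg (f i) (0≤f i)

    sum₂-neg : .{{_ : NonZero n}} (f : V₂) → (∀ i j → f i j < 0ℤ) → sum₂ f < 0ℤ
    sum₂-neg f f<0 = sum-neg _ λ i → sum-neg (f i) (f<0 i)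

    sumSq-nonneg : ∀ {k} cs (q : Fin n → Fin n → Vec Bool k) →
      0ℤ ≤ sum₂ (λ i j → sum₂ λ k l → sumSq cs (q i j) (q k l))
    sumSq-nonneg [] q = ℤ.≤-reflexive (sym (trans (sum₂-cong λ _ _ → sum₂-zero) sum₂-zero))
    sumSq-nonneg (c ∷ cs) q = subst (0ℤ ≤_) (sym (begin
      sum₂ (λ i j → sum₂ λ k l → f i j * f k l + sumSq cs (q i j) (q k l))
        ≡⟨ sum₂-cong (λ i j → sum₂-+ (λ k l → f i j * f k l) (λ k l → sumSq cs (q i j) (q k l))) ⟩
      sum₂ (λ i j → sum₂ (λ k l → f i j * f k l) + sum₂ (λ k l → sumSq cs (q i j) (q k l)))
        ≡⟨ sum₂-+ (λ i j → sum₂ (λ k l → f i j * f k l)) (λ i j → sum₂ (λ k l → sumSq cs (q i j) (q k l))) ⟩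
      sum₂ (λ i j → sum₂ (λ k l → f i j * f k l)) + sum₂ (λ i j → sum₂ λ k l → sumSq cs (q i j) (q k l))
        ≡⟨ cong (_+ _) (sum₂-prod f f) ⟩
      sum₂ f * sum₂ f + sum₂ (λ i j → sum₂ λ k l → sumSq cs (q i j) (q k l)) ∎))
      (0≤+ (0≤i² (sum₂ f)) (sumSq-nonneg cs q))
      where
      f : V₂
      f i j = coeff c (q i j)

    sumSq-nonneg₁ : ∀ {k} cs (q : Fin n → Vec Bool k) → 0ℤ ≤ sum₂ (λ i j → sumSq cs (q i) (q j))
    sumSq-nonneg₁ [] q = ℤ.≤-reflexive (sym sum₂-zero)
    sumSq-nonneg₁ (c ∷ cs) q = subst (0ℤ ≤_) (sym
      (trans (sum₂-+ (λ i j → coeff c (q i) * coeff c (q j)) (λ i j → sumSq cs (q i) (q j)))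
             (cong (_+ _) (sum-prod (λ i → coeff c (q i)) (λ i → coeff c (q i))))))
      (0≤+ (0≤i² (sum λ i → coeff c (q i))) (sumSq-nonneg₁ cs q))

  -- Sums over 6-tuples of vertices and their invariance under relabelling.

  module Patterns {n : ℕ} .{{_ : NonZero n}} (A : Fin n → Fin n → Bool)
    (A-sym : ∀ x y → A x y ≡ A y x) where

    pattern-of : (x y v w s t : Fin n) → Pattern
    pattern-of x y v w s t =
      A x y ∷ A x v ∷ A x w ∷ A x s ∷ A x t ∷ A y v ∷ A y w ∷ A y s ∷
      A y t ∷ A v w ∷ A v s ∷ A v t ∷ A w s ∷ A w t ∷ A s t ∷ []

    total : (Pattern → ℤ) → ℤ
    total g = sum₂ λ x y → sum₂ λ v w → sum₂ λ s t → g (pattern-of x y v w s t)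

    total-cong : ∀ {g h} → (∀ p → g p ≡ h p) → total g ≡ total h
    total-cong eq = sum₂-cong λ x y → sum₂-cong λ v w → sum₂-cong λ s t → eq (pattern-of x y v w s t)

    total-+ : ∀ g h → total (λ p → g p + h p) ≡ total g + total h
    total-+ g h = begin
      total (λ p → g p + h p)
        ≡⟨ sum₂-cong (λ x y → sum₂-cong λ v w → sum₂-+ (λ s t → at₆ g x y v w s t) (λ s t → at₆ h x y v w s t)) ⟩
      (sum₂ λ x y → sum₂ λ v w → sum₂ (at₆ g x y v w) + sum₂ (at₆ h x y v w))
        ≡⟨ sum₂-cong (λ x y → sum₂-+ (λ v w → sum₂ (at₆ g x y v w)) (λ v w → sum₂ (at₆ h x y v w))) ⟩
      (sum₂ λ x y → sum₂ (λ v w → sum₂ (at₆ g x y v w)) + sum₂ (λ v w → sum₂ (at₆ h x y v w)))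
        ≡⟨ sum₂-+ (λ x y → sum₂ λ v w → sum₂ (at₆ g x y v w)) (λ x y → sum₂ λ v w → sum₂ (at₆ h x y v w)) ⟩
      total g + total h ∎
      where
      at₆ : (Pattern → ℤ) → (x y v w s t : Fin n) → ℤ
      at₆ f x y v w s t = f (pattern-of x y v w s t)

    -- A transposition of positions renames two summation variables. Only the bit between the two
    -- exchanged positions gets its arguments reversed, hence the single rewrite by `A-sym` here and
    -- in the four analogues.
    total-swap0 : ∀ g → total (g ∘ swap0) ≡ total g
    total-swap0 g = trans
      (sum₂-cong λ x y → sum₂-cong λ v w → sum₂-cong λ s t → cong g (eq x y v w s t))
      (∑-comm λ x y → sum₂ λ v w → sum₂ λ s t → g (pattern-of y x v w s t))
      where
      eq : ∀ x y v w s t → swap0 (pattern-of x y v w s t) ≡ pattern-of y x v w s t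
      eq x y v w s t rewrite A-sym x y = refl

    total-swap1 : ∀ g → total (g ∘ swap1) ≡ total g
    total-swap1 g = trans
      (sum₂-cong λ x y → sum₂-cong λ v w → sum₂-cong λ s t → cong g (eq x y v w s t))
      (sum-cong-≗ λ x → ∑-comm λ y v → sum λ w → sum₂ λ s t → g (pattern-of x v y w s t))
      where
      eq : ∀ x y v w s t → swap1 (pattern-of x y v w s t) ≡ pattern-of x v y w s t
      eq x y v w s t rewrite A-sym y v = refl

    total-swap2 : ∀ g → total (g ∘ swap2) ≡ total g
    total-swap2 g = trans
      (sum₂-cong λ x y → sum₂-cong λ v w → sum₂-cong λ s t → cong g (eq x y v w s t))
      (sum₂-cong λ x y → ∑-comm λ v w → sum₂ λ s t → g (pattern-of x y w v s t))
      where
      eq : ∀ x y v w s t → swap2 (pattern-of x y v w s t) ≡ pattern-of x y w v s t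
      eq x y v w s t rewrite A-sym v w = refl

    total-swap3 : ∀ g → total (g ∘ swap3) ≡ total g
    total-swap3 g = trans
      (sum₂-cong λ x y → sum₂-cong λ v w → sum₂-cong λ s t → cong g (eq x y v w s t))
      (sum₂-cong λ x y → sum-cong-≗ λ v → ∑-comm λ w s → sum λ t → g (pattern-of x y v s w t))
      where
      eq : ∀ x y v w s t → swap3 (pattern-of x y v w s t) ≡ pattern-of x y v s w t
      eq x y v w s t rewrite A-sym w s = refl

    total-swap4 : ∀ g → total (g ∘ swap4) ≡ total g
    total-swap4 g = trans
      (sum₂-cong λ x y → sum₂-cong λ v w → sum₂-cong λ s t → cong g (eq x y v w s t))
      (sum₂-cong λ x y → sum₂-cong λ v w → ∑-comm λ s t → g (pattern-of x y v w t s))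
      where
      eq : ∀ x y v w s t → swap4 (pattern-of x y v w s t) ≡ pattern-of x y v w t s
      eq x y v w s t rewrite A-sym s t = refl

    private
      coset-step : ∀ k g h → total h ≡ total g → total (coset h k) ≡ + suc k * total h →
        total (λ p → g p + coset h k p) ≡ + suc (suc k) * total g
      coset-step k g h h≡g eq = begin
        total (λ p → g p + coset h k p)  ≡⟨ total-+ g (coset h k) ⟩
        total g + total (coset h k)      ≡⟨ cong (_+_ (total g)) (trans eq (cong (_*_ (+ suc k)) h≡g)) ⟩
        total g + + suc k * total g      ≡⟨ sym (ℤ.suc-* (+ suc k) (total g)) ⟩
        + suc (suc k) * total g          ∎

    total-coset₀ : ∀ g → total (coset g 0) ≡ + 1 * total g
    total-coset₀ g = sym (ℤ.*-identityˡ (total g))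

    total-coset₁ : ∀ g → total (coset g 1) ≡ + 2 * total g
    total-coset₁ g = coset-step 0 g (g ∘ swap0) (total-swap0 g) (total-coset₀ (g ∘ swap0))

    total-coset₂ : ∀ g → total (coset g 2) ≡ + 3 * total g
    total-coset₂ g = coset-step 1 g (g ∘ swap1) (total-swap1 g) (total-coset₁ (g ∘ swap1))

    total-coset₃ : ∀ g → total (coset g 3) ≡ + 4 * total g
    total-coset₃ g = coset-step 2 g (g ∘ swap2) (total-swap2 g) (total-coset₂ (g ∘ swap2))

    total-coset₄ : ∀ g → total (coset g 4) ≡ + 5 * total g
    total-coset₄ g = coset-step 3 g (g ∘ swap3) (total-swap3 g) (total-coset₃ (g ∘ swap3))

    total-coset₅ : ∀ g → total (coset g 5) ≡ + 6 * total g
    total-coset₅ g = coset-step 4 g (g ∘ swap4) (total-swap4 g) (total-coset₄ (g ∘ swap4))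

    total-stage : ∀ k → (∀ g → total (coset g k) ≡ + suc k * total g) →
      ∀ t → total (lookupᵗ (stage k t)) ≡ + suc k * total (lookupᵗ t)
    total-stage k eq t = trans (total-cong (lookup∘tabulate (coset (lookupᵗ t) k))) (eq (lookupᵗ t))

    private
      chain : ∀ {a b c d e f} → a ≡ + 2 * b → c ≡ + 3 * a → d ≡ + 4 * c → e ≡ + 5 * d → f ≡ + 6 * e →
        f ≡ + 720 * b
      chain {b = b} refl refl refl refl refl =
        solve 1 (λ z → con (+ 6) :* (con (+ 5) :* (con (+ 4) :* (con (+ 3) :* (con (+ 2) :* z))))
                       := con (+ 720) :* z) refl b

    total-symmetrize : ∀ t → total (lookupᵗ (symmetrize t)) ≡ + 720 * total (lookupᵗ t)
    total-symmetrize t = chain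
      (total-stage 1 total-coset₁ t)
      (total-stage 2 total-coset₂ (stage 1 t))
      (total-stage 3 total-coset₃ (stage 2 (stage 1 t)))
      (total-stage 4 total-coset₄ (stage 3 (stage 2 (stage 1 t))))
      (total-stage 5 total-coset₅ (stage 4 (stage 3 (stage 2 (stage 1 t)))))

    private
      ∨-false : ∀ {a b} → a ≡ false → b ≡ false → a ∨ b ≡ false
      ∨-false refl refl = refl

    module _ (△-free : ∀ x y z → A x y ∧ A x z ∧ A y z ≡ false) where

      pattern-△-free : ∀ x y v w s t → triangle (pattern-of x y v w s t) ≡ false
      pattern-△-free x y v w s t =
        ∨-false (△-free x y v) (
        ∨-false (△-free x y w) (
        ∨-false (△-free x y s) (
        ∨-false (△-free x y t) (
        ∨-false (△-free x v w) (
        ∨-false (△-free x v s) (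
        ∨-false (△-free x v t) (
        ∨-false (△-free x w s) (
        ∨-false (△-free x w t) (
        ∨-false (△-free x s t) (
        ∨-false (△-free y v w) (
        ∨-false (△-free y v s) (
        ∨-false (△-free y v t) (
        ∨-false (△-free y w s) (
        ∨-false (△-free y w t) (
        ∨-false (△-free y s t) (
        ∨-false (△-free v w s) (
        ∨-false (△-free v w t) (
        ∨-false (△-free v s t) (
        △-free w s t)))))))))))))))))))

      total-neg : ∀ t → allLeaves (λ p c → triangle p ∨ isNeg c) (symmetrize t) ≡ true →
        total (lookupᵗ t) < 0ℤ
      total-neg t checked = ℤ.*-cancelˡ-<-nonNeg (+ 720) (subst (_< 0ℤ) (total-symmetrize t)
        (sum₂-neg _ λ x y → sum₂-neg _ λ v w → sum₂-neg _ λ s u →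
          neg (pattern-of x y v w s u) (pattern-△-free x y v w s u)))
        where
        isNeg-sound : ∀ i → isNeg i ≡ true → i < 0ℤ
        isNeg-sound -[1+ _ ] _ = -<+

        neg : ∀ p → triangle p ≡ false → lookupᵗ (symmetrize t) p < 0ℤ
        neg p eq = isNeg-sound _ (subst (λ b → b ∨ isNeg (lookupᵗ (symmetrize t) p) ≡ true) eq
          (allLeaves-sound (λ p c → triangle p ∨ isNeg c) (symmetrize t) checked p))

      total-cert<0 : total cert < 0ℤ
      total-cert<0 = subst (_< 0ℤ) (total-cong (lookup∘tabulate cert)) (total-neg certTable checked)

  -- The inequality T ≥ 0 for one pair of vertices.

  0≤pos : ∀ {k} → 0ℤ ≤ + k
  0≤pos = +≤+ z≤n

  cancel-pos : ∀ {k i} → 0ℤ < k → 0ℤ ≤ k * i → 0ℤ ≤ i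
  cancel-pos {k} {i} 0<k 0≤ki = ℤ.*-cancelˡ-≤-pos 0ℤ i k {{positive 0<k}}
    (subst (_≤ k * i) (sym (ℤ.*-zeroʳ k)) 0≤ki)

  module _ (n d r e ρ : ℤ) where
    private
      h = n - + 2 * d
      K = + 512 * e - + 27 * n * n - + 54 * n * h
      B = + 512 * e - + 1024 * ρ - + 27 * n * n - + 54 * n * h + + 108 * n * r
      Z = + 7 * (r + d) - + 3 * n

      weight slack : ℤ → ℤ → ℤ
      weight α β = α * (n - d) - β * r
      slack α β = + 128 * (α * α * e - + 2 * (α * β * ρ)) - + 27 * (weight α β * weight α β)

    -- K ≥ 0 is the case (α, β) = (1, 0).  If 2r ≤ h, the case (1, 1) gives B ≥ 27 (h - 2r)².  Otherwise
    -- the case (2r, h) is Y ≥ 0 up to a positive factor, and 4 times the claimed expression is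
    -- 56 n Y + K (7 (2r - h) - n)².
    removal-inequality : 0ℤ ≤ n → 0ℤ ≤ h →
      (∀ α β → 0ℤ ≤ β → β ≤ α → n * α ≤ + 2 * weight α β → 0ℤ ≤ slack α β) →
      0ℤ ≤ + 7 * n * h * B + K * (Z * Z)
    removal-inequality 0≤n 0≤h key = helper (ℤ.≤-total (+ 2 * r) h)
      where
      0≤K : 0ℤ ≤ K
      0≤K = subst (0ℤ ≤_)
        (solve 5 (λ n d r e ρ → let h = n :- con (+ 2) :* d
                                    w = con 1ℤ :* (n :- d) :- con 0ℤ :* r in
           con (+ 4) :* (con (+ 128) :* (con 1ℤ :* con 1ℤ :* e :- con (+ 2) :* (con 1ℤ :* con 0ℤ :* ρ))
                         :- con (+ 27) :* (w :* w)) :+ con (+ 27) :* (h :* h)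
           := con (+ 512) :* e :- con (+ 27) :* n :* n :- con (+ 54) :* n :* h) refl n d r e ρ)
        (0≤+ (0≤* (0≤pos {4}) (key 1ℤ 0ℤ 0≤pos 0≤pos n≤)) (0≤* (0≤pos {27}) (0≤i² h)))
        where
        n≤ : n * 1ℤ ≤ + 2 * weight 1ℤ 0ℤ
        n≤ = ℤ.0≤i-j⇒j≤i (subst (0ℤ ≤_)
          (solve 3 (λ n d r → n :- con (+ 2) :* d
             := con (+ 2) :* (con 1ℤ :* (n :- d) :- con 0ℤ :* r) :- n :* con 1ℤ) refl n d r) 0≤h)

      helper : _ → 0ℤ ≤ + 7 * n * h * B + K * (Z * Z)
      helper (inj₁ 2r≤h) = 0≤+ (0≤* (0≤* (0≤* (0≤pos {7}) 0≤n) 0≤h) 0≤B) (0≤* 0≤K (0≤i² Z))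
        where
        n≤ : n * 1ℤ ≤ + 2 * weight 1ℤ 1ℤ
        n≤ = ℤ.0≤i-j⇒j≤i (subst (0ℤ ≤_)
          (solve 3 (λ n d r → (n :- con (+ 2) :* d) :- con (+ 2) :* r
             := con (+ 2) :* (con 1ℤ :* (n :- d) :- con 1ℤ :* r) :- n :* con 1ℤ) refl n d r)
          (ℤ.i≤j⇒0≤j-i 2r≤h))
        0≤B : 0ℤ ≤ B
        0≤B = subst (0ℤ ≤_)
          (solve 5 (λ n d r e ρ → let h = n :- con (+ 2) :* d
                                      w = con 1ℤ :* (n :- d) :- con 1ℤ :* r
                                      u = h :- con (+ 2) :* r in
             con (+ 4) :* (con (+ 128) :* (con 1ℤ :* con 1ℤ :* e :- con (+ 2) :* (con 1ℤ :* con 1ℤ :* ρ))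
                           :- con (+ 27) :* (w :* w)) :+ con (+ 27) :* (u :* u)
             := con (+ 512) :* e :- con (+ 1024) :* ρ :- con (+ 27) :* n :* n :- con (+ 54) :* n :* h
                :+ con (+ 108) :* n :* r) refl n d r e ρ)
          (0≤+ (0≤* (0≤pos {4}) (key 1ℤ 1ℤ 0≤pos ℤ.≤-refl n≤)) (0≤* (0≤pos {27}) (0≤i² (h - + 2 * r))))
      -- The weighting (2r, h) yields only `2r · Y ≥ 0`, so `2r` has to be cancelled. If it is 0,
      -- then `2r ≤ h` as well and the first case applies.
      helper (inj₂ h≤2r) with ℤ.<-cmp 0ℤ (+ 2 * r)
      ... | tri> _ _ 2r<0 = ⊥-elim (ℤ.<⇒≱ 2r<0 (ℤ.≤-trans 0≤h h≤2r))
      ... | tri≈ _ 0≡2r _ = helper (inj₁ (subst (_≤ h) 0≡2r 0≤h))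
      ... | tri< 0<2r _ _ = cancel-pos {+ 4} (+<+ (s≤s z≤n)) (subst (0ℤ ≤_)
        (solve 5 (λ n d r e ρ → let h = n :- con (+ 2) :* d
                                    τ = con (+ 2) :* r :- h
                                    K = con (+ 512) :* e :- con (+ 27) :* n :* n :- con (+ 54) :* n :* h
                                    Z = con (+ 7) :* (r :+ d) :- con (+ 3) :* n
                                    u = con (+ 7) :* τ :- n in
           con (+ 56) :* n :* (con (+ 512) :* (r :* e :- h :* ρ) :- con (+ 27) :* r :* n :* n) :+ K :* (u :* u)
           := con (+ 4) :* (con (+ 7) :* n :* h :* (con (+ 512) :* e :- con (+ 1024) :* ρ :- con (+ 27) :* n :* n
                :- con (+ 54) :* n :* h :+ con (+ 108) :* n :* r) :+ K :* (Z :* Z))) refl n d r e ρ)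
        (0≤+ (0≤* (0≤* (0≤pos {56}) 0≤n) 0≤Y) (0≤* 0≤K (0≤i² (+ 7 * (+ 2 * r - h) - n)))))
        where
        Y = + 512 * (r * e - h * ρ) - + 27 * r * n * n
        0≤Y : 0ℤ ≤ Y
        0≤Y = cancel-pos 0<2r (subst (0ℤ ≤_)
          (solve 5 (λ n d r e ρ → let h = n :- con (+ 2) :* d
                                      α = con (+ 2) :* r
                                      w = α :* (n :- d) :- h :* r in
             con (+ 2) :* (con (+ 128) :* (α :* α :* e :- con (+ 2) :* (α :* h :* ρ)) :- con (+ 27) :* (w :* w))
             := α :* (con (+ 512) :* (r :* e :- h :* ρ) :- con (+ 27) :* r :* n :* n)) refl n d r e ρ)
          (0≤* (0≤pos {2}) (key (+ 2 * r) h 0≤h h≤2r (ℤ.≤-reflexive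
            (solve 3 (λ n d r → let h = n :- con (+ 2) :* d ; α = con (+ 2) :* r in
               n :* α := con (+ 2) :* (α :* (n :- d) :- h :* r)) refl n d r)))))

  0<* : ∀ {i j} → 0ℤ < i → 0ℤ < j → 0ℤ < i * j
  0<* {i} {j} 0<i 0<j = subst (_< i * j) (ℤ.*-zeroʳ i) (ℤ.*-monoˡ-<-pos i {{positive 0<i}} 0<j)

  bit-∧-zero : ∀ a b c → a ∧ b ∧ c ≡ false → bit a * (bit b * bit c) ≡ 0ℤ
  bit-∧-zero false b     c     _ = ℤ.*-zeroˡ (bit b * bit c)
  bit-∧-zero true  false c     _ = refl
  bit-∧-zero true  true  false _ = refl

  sum-*ˡ : ∀ {n} c (f : Fin n → ℤ) → sum (λ i → c * f i) ≡ c * sum f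
  sum-*ˡ c f = sym (*-distribˡ-sum c f)

  sum₂-sum₂-*ˡ : ∀ {n} c (f : (i j k l : Fin n) → ℤ) →
    sum₂ (λ i j → sum₂ λ k l → c * f i j k l) ≡ c * sum₂ λ i j → sum₂ λ k l → f i j k l
  sum₂-sum₂-*ˡ c f = trans (sum₂-cong λ i j → sum₂-*ˡ c (f i j)) (sum₂-*ˡ c λ i j → sum₂ (f i j))

  sum₂-sum₂-+ : ∀ {n} (f g : (i j k l : Fin n) → ℤ) →
    sum₂ (λ i j → sum₂ λ k l → f i j k l + g i j k l) ≡
    sum₂ (λ i j → sum₂ λ k l → f i j k l) + sum₂ (λ i j → sum₂ λ k l → g i j k l)
  sum₂-sum₂-+ f g = trans (sum₂-cong λ i j → sum₂-+ (f i j) (g i j))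
                          (sum₂-+ (λ i j → sum₂ (f i j)) (λ i j → sum₂ (g i j)))

  -- The contradiction between (∗) and the certificate.

  module _ {n : ℕ} .{{_ : NonZero n}} (A : Fin n → Fin n → Bool)
    (A-sym : ∀ x y → A x y ≡ A y x) (△-free : ∀ x y z → A x y ∧ A x z ∧ A y z ≡ false) where

    open Patterns A A-sym

    quad : (Fin n → ℤ) → ℤ
    quad ν = sum₂ λ v w → bit (A v w) * (ν v * ν w)

    module _ (dense : ∀ ν M → (∀ v → 0ℤ ≤ ν v) → (∀ v → ν v ≤ M) → + n * M ≤ + 2 * sum ν →
                      0ℤ ≤ + 128 * quad ν - + 27 * (sum ν * sum ν)) where

      deg : Fin n → ℤ
      deg x = sum λ v → bit (A x v)

      private
        N = + n

        quad-nbhd : ∀ x → quad (λ v → bit (A x v)) ≡ 0ℤ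
        quad-nbhd x = trans (sum₂-cong λ v w → trans (ℤ.*-comm (bit (A v w)) _)
          (trans (ℤ.*-assoc (bit (A x v)) (bit (A x w)) (bit (A v w)))
            (bit-∧-zero (A x v) (A x w) (A v w) (△-free x v w)))) (sum₂-zero {n})

      -- Otherwise half of the vertices could be chosen inside an independent neighbourhood.
      0≤n-2deg : ∀ x → 0ℤ ≤ N - + 2 * deg x
      0≤n-2deg x with ℤ.≤-total (+ 2 * deg x) N
      ... | inj₁ 2d≤N = ℤ.i≤j⇒0≤j-i 2d≤N
      ... | inj₂ N≤2d = ⊥-elim (ℤ.<⇒≱ 0<27d² (ℤ.0≤i-j⇒j≤i (subst (λ q → 0ℤ ≤ + 128 * q - + 27 * (deg x * deg x))
          (quad-nbhd x) (dense (λ v → bit (A x v)) 1ℤ (λ v → 0≤bit (A x v)) (λ v → bit≤1 (A x v))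
            (ℤ.≤-trans (ℤ.≤-reflexive (ℤ.*-identityʳ N)) N≤2d)))))
        where
        bit≤1 : ∀ b → bit b ≤ 1ℤ
        bit≤1 false = +≤+ z≤n
        bit≤1 true  = +≤+ (s≤s z≤n)
        0<N : 0ℤ < N
        0<N = +<+ (ℕ.>-nonZero⁻¹ n)
        0<d : 0ℤ < deg x
        0<d = ℤ.*-cancelˡ-<-nonNeg (+ 2) (ℤ.<-≤-trans 0<N N≤2d)
        0<27d² : + 128 * 0ℤ < + 27 * (deg x * deg x)
        0<27d² = 0<* {+ 27} (+<+ (s≤s z≤n)) (0<* 0<d 0<d)

      module _ (x y : Fin n) where

        private
          W Rᵥ : Fin n → ℤ
          W v  = co-bit (A x v)
          Rᵥ v = R (A x v) (A y v)
          EWᵥ RWᵥ : Fin n → Fin n → ℤ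
          EWᵥ v w = EW (A x v) (A x w) (A v w)
          RWᵥ v w = RW (A x v) (A y v) (A x w) (A v w)
          d r e ρ : ℤ
          d = deg x
          r = sum Rᵥ
          e = sum₂ EWᵥ
          ρ = sum₂ RWᵥ

          sum-W : sum W ≡ N - d
          sum-W = trans (sum-- (λ _ → 1ℤ) (λ v → bit (A x v)))
            (cong (_- d) (trans (sum-const n 1ℤ) (ℤ.*-identityʳ N)))

          -- α on V ∖ N(x), lowered to α - β on N(y) ∖ N(x).
          ν : ℤ → ℤ → Fin n → ℤ
          ν α β v = α * W v - β * Rᵥ v

          sum-ν : ∀ α β → sum (ν α β) ≡ α * (N - d) - β * r
          sum-ν α β = trans (sum-- (λ v → α * W v) (λ v → β * Rᵥ v))
            (cong₂ _-_ (trans (sum-*ˡ α W) (cong (α *_) sum-W)) (sum-*ˡ β Rᵥ))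

          -- There is no β² term because it would count pairs adjacent inside N(y), which is
          -- independent in a triangle-free graph. The two mixed terms agree after exchanging `v`
          -- and `w`.
          quad-ν : ∀ α β → quad (ν α β) ≡ α * α * e - + 2 * (α * β * ρ)
          quad-ν α β = begin
            quad (ν α β)
              ≡⟨ sum₂-cong (λ v w → expand (△-free y v w)) ⟩
            (sum₂ λ v w → α * α * EWᵥ v w - (α * β * RWᵥ v w + α * β * RWᵥ w v))
              ≡⟨ sum₂-- (λ v w → α * α * EWᵥ v w) (λ v w → α * β * RWᵥ v w + α * β * RWᵥ w v) ⟩
            (sum₂ λ v w → α * α * EWᵥ v w) - sum₂ (λ v w → α * β * RWᵥ v w + α * β * RWᵥ w v)
              ≡⟨ cong₂ _-_ (sum₂-*ˡ (α * α) EWᵥ)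
                   (trans (sum₂-+ (λ v w → α * β * RWᵥ v w) (λ v w → α * β * RWᵥ w v))
                     (cong₂ _+_ (sum₂-*ˡ (α * β) RWᵥ)
                       (trans (∑-comm (λ v w → α * β * RWᵥ w v)) (sum₂-*ˡ (α * β) RWᵥ)))) ⟩
            α * α * e - (α * β * ρ + α * β * ρ)
              ≡⟨ solve 2 (λ p q → p :- (q :+ q) := p :- con (+ 2) :* q) refl (α * α * e) (α * β * ρ) ⟩
            α * α * e - + 2 * (α * β * ρ) ∎
            where
            expand : ∀ {v w} → A y v ∧ A y w ∧ A v w ≡ false →
              bit (A v w) * (ν α β v * ν α β w) ≡ α * α * EWᵥ v w - (α * β * RWᵥ v w + α * β * RWᵥ w v)
            expand {v} {w} tf rewrite A-sym w v = begin
              a * ((α * wv - β * (bv * wv)) * (α * ww - β * (bw * ww)))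
                ≡⟨ solve 7 (λ α β a wv ww bv bw →
                     a :* ((α :* wv :- β :* (bv :* wv)) :* (α :* ww :- β :* (bw :* ww)))
                     := (α :* α :* (a :* (wv :* ww))
                          :- (α :* β :* (a :* (bv :* wv :* ww)) :+ α :* β :* (a :* (bw :* ww :* wv))))
                        :+ β :* β :* wv :* ww :* (bv :* (bw :* a)))
                     refl α β a wv ww bv bw ⟩
              rest + β * β * wv * ww * (bv * (bw * a))
                ≡⟨ cong (λ z → rest + β * β * wv * ww * z) (bit-∧-zero (A y v) (A y w) (A v w) tf) ⟩
              rest + β * β * wv * ww * 0ℤ
                ≡⟨ trans (cong (_+_ rest) (ℤ.*-zeroʳ (β * β * wv * ww))) (ℤ.+-identityʳ rest) ⟩
              rest ∎
              where
              a = bit (A v w) ; wv = W v ; ww = W w ; bv = bit (A y v) ; bw = bit (A y w)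
              rest = α * α * (a * (wv * ww)) - (α * β * (a * (bv * wv * ww)) + α * β * (a * (bw * ww * wv)))

          ν-bounds : ∀ α β → 0ℤ ≤ β → β ≤ α → ∀ v → 0ℤ ≤ ν α β v × ν α β v ≤ α
          ν-bounds α β 0≤β β≤α v with A x v | A y v
          ... | true  | b     = subst (λ z → 0ℤ ≤ z × z ≤ α)
            (solve 3 (λ α β b → con 0ℤ := α :* con 0ℤ :- β :* (b :* con 0ℤ)) refl α β (bit b))
            (ℤ.≤-refl , ℤ.≤-trans 0≤β β≤α)
          ... | false | false = subst (λ z → 0ℤ ≤ z × z ≤ α)
            (solve 2 (λ α β → α := α :* con 1ℤ :- β :* con 0ℤ) refl α β)
            (ℤ.≤-trans 0≤β β≤α , ℤ.≤-refl)
          ... | false | true  = subst (λ z → 0ℤ ≤ z × z ≤ α)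
            (solve 2 (λ α β → α :- β := α :* con 1ℤ :- β :* con 1ℤ) refl α β)
            (ℤ.i≤j⇒0≤j-i β≤α , ℤ.i-j≤i α β {{nonNegative 0≤β}})

          slack≥0 : ∀ α β → 0ℤ ≤ β → β ≤ α → N * α ≤ + 2 * (α * (N - d) - β * r) →
            0ℤ ≤ + 128 * (α * α * e - + 2 * (α * β * ρ)) - + 27 * ((α * (N - d) - β * r) * (α * (N - d) - β * r))
          slack≥0 α β 0≤β β≤α Nα≤ = subst₂ (λ q s → 0ℤ ≤ + 128 * q - + 27 * (s * s)) (quad-ν α β) (sum-ν α β)
            (dense (ν α β) α (λ v → proj₁ (ν-bounds α β 0≤β β≤α v)) (λ v → proj₂ (ν-bounds α β 0≤β β≤α v))
              (subst (λ s → N * α ≤ + 2 * s) (sym (sum-ν α β)) Nα≤))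

          total-slack : ℤ
          total-slack = + 7 * N * (N - + 2 * d) *
              (+ 512 * e - + 1024 * ρ - + 27 * N * N - + 54 * N * (N - + 2 * d) + + 108 * N * r)
            + (+ 512 * e - + 27 * N * N - + 54 * N * (N - + 2 * d)) * (Z * Z)
            where Z = + 7 * (r + d) - + 3 * N

          0≤total-slack : 0ℤ ≤ total-slack
          0≤total-slack = removal-inequality N d r e ρ 0≤pos (0≤n-2deg x) slack≥0

          Hᵥ Lᵥ : Fin n → ℤ
          Hᵥ s = H (A x s)
          Lᵥ s = L (A x s) (A y s)

          sum-H : sum Hᵥ ≡ N - + 2 * d
          sum-H = trans (sum-- (λ _ → 1ℤ) (λ s → + 2 * bit (A x s)))
            (cong₂ _-_ (trans (sum-const n 1ℤ) (ℤ.*-identityʳ N)) (sum-*ˡ (+ 2) (λ s → bit (A x s))))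

          sum-L : sum Lᵥ ≡ + 7 * (r + d) - N * + 3
          sum-L = trans (sum-- (λ s → + 7 * (Rᵥ s + bit (A x s))) (λ _ → + 3))
            (cong₂ _-_ (trans (sum-*ˡ (+ 7) (λ s → Rᵥ s + bit (A x s))) 
                (cong (_*_ (+ 7)) (∑-distrib-+ Rᵥ (λ s → bit (A x s)))))
              (sum-const n (+ 3)))

          sum-512E : sum₂ (λ v w → + 512 * EWᵥ v w) ≡ + 512 * e
          sum-512E = sum₂-*ˡ (+ 512) EWᵥ

          -- With `B`, `K`, `Z` as in `removal-inequality`, the products of the sums of `f₁`, `g₁`
          -- and of `f₂`, `g₂` add up to `7 n h B`, and that of `f₃`, `g₃` is `K Z²`. Each missing
          -- factor `n` is supplied by a summation over a vertex that the term does not mention.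
          f₁ f₂ f₃ g₁ g₂ g₃ : Fin n → Fin n → ℤ
          f₁ v w = + 512 * EWᵥ v w - + 1024 * RWᵥ v w - + 27
          f₂ v w = 1ℤ
          f₃ v w = + 512 * EWᵥ v w - + 27 - + 54 * Hᵥ v
          g₁ s t = + 7 * Hᵥ s * 1ℤ
          g₂ s t = + 7 * Hᵥ s * (+ 108 * Rᵥ t - + 54 * Hᵥ t)
          g₃ s t = Lᵥ s * Lᵥ t

          sum-f₁ : sum₂ f₁ ≡ + 512 * e - + 1024 * ρ - N * (N * + 27)
          sum-f₁ = trans (sum₂-- (λ v w → + 512 * EWᵥ v w - + 1024 * RWᵥ v w) (λ _ _ → + 27))
            (cong₂ _-_ (trans (sum₂-- (λ v w → + 512 * EWᵥ v w) (λ v w → + 1024 * RWᵥ v w))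
                          (cong₂ _-_ sum-512E (sum₂-*ˡ (+ 1024) RWᵥ)))
                       (sum₂-const {n} (+ 27)))

          sum-f₃ : sum₂ f₃ ≡ + 512 * e - N * (N * + 27) - N * (+ 54 * (N - + 2 * d))
          sum-f₃ = trans (sum₂-- (λ v w → + 512 * EWᵥ v w - + 27) (λ v _ → + 54 * Hᵥ v))
            (cong₂ _-_ (trans (sum₂-- (λ v w → + 512 * EWᵥ v w) (λ _ _ → + 27))
                          (cong₂ _-_ sum-512E (sum₂-const {n} (+ 27))))
                       (trans (∑-comm {n} {n} (λ v _ → + 54 * Hᵥ v)) (trans (sum-const n (sum λ v → + 54 * Hᵥ v))
                         (cong (_*_ N) (trans (sum-*ˡ (+ 54) Hᵥ) (cong (_*_ (+ 54)) sum-H))))))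

          sum-g₁ : sum₂ g₁ ≡ + 7 * (N - + 2 * d) * (N * 1ℤ)
          sum-g₁ = trans (sum-prod (λ s → + 7 * Hᵥ s) (λ _ → 1ℤ))
            (cong₂ _*_ (trans (sum-*ˡ (+ 7) Hᵥ) (cong (_*_ (+ 7)) sum-H)) (sum-const n 1ℤ))

          sum-g₂ : sum₂ g₂ ≡ + 7 * (N - + 2 * d) * (+ 108 * r - + 54 * (N - + 2 * d))
          sum-g₂ = trans (sum-prod (λ s → + 7 * Hᵥ s) (λ t → + 108 * Rᵥ t - + 54 * Hᵥ t))
            (cong₂ _*_ (trans (sum-*ˡ (+ 7) Hᵥ) (cong (_*_ (+ 7)) sum-H))
              (trans (sum-- (λ t → + 108 * Rᵥ t) (λ t → + 54 * Hᵥ t))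
                (cong₂ _-_ (sum-*ˡ (+ 108) Rᵥ) (trans (sum-*ˡ (+ 54) Hᵥ) (cong (_*_ (+ 54)) sum-H)))))

          sum-g₃ : sum₂ g₃ ≡ (+ 7 * (r + d) - N * + 3) * (+ 7 * (r + d) - N * + 3)
          sum-g₃ = trans (sum-prod Lᵥ Lᵥ) (cong₂ _*_ sum-L sum-L)

          total-slack-sum : sum₂ (λ v w → sum₂ λ s t → f₁ v w * g₁ s t + f₂ v w * g₂ s t + f₃ v w * g₃ s t)
            ≡ total-slack
          total-slack-sum = begin
            sum₂ (λ v w → sum₂ λ s t → f₁ v w * g₁ s t + f₂ v w * g₂ s t + f₃ v w * g₃ s t)
              ≡⟨ trans (sum₂-sum₂-+ (λ v w s t → f₁ v w * g₁ s t + f₂ v w * g₂ s t) (λ v w s t → f₃ v w * g₃ s t))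
                   (cong₂ _+_ (trans (sum₂-sum₂-+ (λ v w s t → f₁ v w * g₁ s t) (λ v w s t → f₂ v w * g₂ s t))
                     (cong₂ _+_ (sum₂-prod f₁ g₁) (sum₂-prod f₂ g₂))) (sum₂-prod f₃ g₃)) ⟩
            sum₂ f₁ * sum₂ g₁ + sum₂ f₂ * sum₂ g₂ + sum₂ f₃ * sum₂ g₃
              ≡⟨ cong₂ _+_ (cong₂ _+_ (cong₂ _*_ sum-f₁ sum-g₁) (cong₂ _*_ (sum₂-const {n} 1ℤ) sum-g₂))
                   (cong₂ _*_ sum-f₃ sum-g₃) ⟩
            _
              ≡⟨ solve 5 (λ N d r e ρ →
                   let h = N :- con (+ 2) :* d
                       l = con (+ 7) :* (r :+ d) :- N :* con (+ 3)
                       Z = con (+ 7) :* (r :+ d) :- con (+ 3) :* N in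
                   (con (+ 512) :* e :- con (+ 1024) :* ρ :- N :* (N :* con (+ 27))) :* (con (+ 7) :* h :* (N :* con 1ℤ))
                   :+ N :* (N :* con 1ℤ) :* (con (+ 7) :* h :* (con (+ 108) :* r :- con (+ 54) :* h))
                   :+ (con (+ 512) :* e :- N :* (N :* con (+ 27)) :- N :* (con (+ 54) :* h)) :* (l :* l)
                   := con (+ 7) :* N :* h :* (con (+ 512) :* e :- con (+ 1024) :* ρ :- con (+ 27) :* N :* N
                        :- con (+ 54) :* N :* h :+ con (+ 108) :* N :* r)
                      :+ (con (+ 512) :* e :- con (+ 27) :* N :* N :- con (+ 54) :* N :* h) :* (Z :* Z))
                   refl N d r e ρ ⟩
            total-slack ∎

        removal-sum : 0ℤ ≤ sum₂ (λ v w → sum₂ λ s t → f₁ v w * g₁ s t + f₂ v w * g₂ s t + f₃ v w * g₃ s t)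
        removal-sum = subst (0ℤ ≤_) (sym total-slack-sum) 0≤total-slack

      certT≥0 : 0ℤ ≤ total certT
      certT≥0 = sum₂-nonneg _ λ x y → subst (0ℤ ≤_)
        (sym (trans (sum₂-sum₂-*ˡ (co-bit (A x y)) (λ v w s t → + 16384 * body x y v w s t))
             (cong (_*_ (co-bit (A x y))) (sum₂-sum₂-*ˡ (+ 16384) (body x y)))))
        (0≤* (0≤co-bit (A x y)) (0≤* (0≤pos {16384}) (removal-sum x y)))
        where
        body : (x y v w s t : Fin n) → ℤ
        body x y v w s t =
          (+ 512 * EW (A x v) (A x w) (A v w) - + 1024 * RW (A x v) (A y v) (A x w) (A v w) - + 27)
            * (+ 7 * H (A x s) * 1ℤ)
          + 1ℤ * (+ 7 * H (A x s) * (+ 108 * R (A x t) (A y t) - + 54 * H (A x t)))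
          + (+ 512 * EW (A x v) (A x w) (A v w) - + 27 - + 54 * H (A x v))
            * (L (A x s) (A y s) * L (A x t) (A y t))

      private
        rooted₂ : (x y v w : Fin n) → Vec Bool 5
        rooted₂ x y v w = A x v ∷ A y v ∷ A x w ∷ A y w ∷ A v w ∷ []

        rooted₄ : (x y v w s : Fin n) → Vec Bool 4
        rooted₄ x y v w s = A x s ∷ A y s ∷ A v s ∷ A w s ∷ []

        scaled-sumSq : ∀ cs (x y : Fin n) c → 0ℤ ≤ c →
          0ℤ ≤ sum₂ λ v w → sum₂ λ s t → c * sumSq cs (rooted₂ x y v w) (rooted₂ x y s t)
        scaled-sumSq cs x y c 0≤c = subst (0ℤ ≤_)
          (sym (sum₂-sum₂-*ˡ c (λ v w s t → sumSq cs (rooted₂ x y v w) (rooted₂ x y s t))))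
          (0≤* 0≤c (sumSq-nonneg cs (rooted₂ x y)))

        scaled-sumSq₁ : ∀ cs (x y v w : Fin n) c → 0ℤ ≤ c →
          0ℤ ≤ sum₂ λ s t → c * sumSq cs (rooted₄ x y v w s) (rooted₄ x y v w t)
        scaled-sumSq₁ cs x y v w c 0≤c = subst (0ℤ ≤_)
          (sym (sum₂-*ˡ c (λ s t → sumSq cs (rooted₄ x y v w s) (rooted₄ x y v w t))))
          (0≤* 0≤c (sumSq-nonneg₁ cs (rooted₄ x y v w)))

      cert≥0 : 0ℤ ≤ total cert
      cert≥0 = subst (0ℤ ≤_) (sym split) (0≤+ certT≥0 (0≤+
        (sum₂-nonneg _ λ x y → scaled-sumSq nonedgeSq x y (co-bit (A x y)) (0≤co-bit (A x y))) (0≤+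
        (sum₂-nonneg _ λ x y → scaled-sumSq edgeSq x y (bit (A x y)) (0≤bit (A x y))) (0≤+
        (sum₂-nonneg _ λ x y → sum₂-nonneg _ λ v w → scaled-sumSq₁ oneEdgeSq x y v w
          (bit (A x y ∧ not (A x v) ∧ not (A x w) ∧ not (A y v) ∧ not (A y w) ∧ not (A v w)))
          (0≤bit (A x y ∧ not (A x v) ∧ not (A x w) ∧ not (A y v) ∧ not (A y w) ∧ not (A v w))))
        (sum₂-nonneg _ λ x y → sum₂-nonneg _ λ v w → scaled-sumSq₁ cherrySq x y v w
          (bit (A x y ∧ A x v ∧ not (A x w) ∧ not (A y v) ∧ not (A y w) ∧ not (A v w)))
          (0≤bit (A x y ∧ A x v ∧ not (A x w) ∧ not (A y v) ∧ not (A y w) ∧ not (A v w))))))))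
        where
        split : total cert ≡
          total certT + (total certNonedge + (total certEdge + (total certOneEdge + total certCherry)))
        split =
          trans (total-+ certT (λ p → certNonedge p + (certEdge p + (certOneEdge p + certCherry p))))
            (cong (_+_ (total certT))
          (trans (total-+ certNonedge (λ p → certEdge p + (certOneEdge p + certCherry p)))
            (cong (_+_ (total certNonedge))
          (trans (total-+ certEdge (λ p → certOneEdge p + certCherry p))
            (cong (_+_ (total certEdge)) (total-+ certOneEdge certCherry))))))

      not-dense : ⊥
      not-dense = ℤ.<⇒≱ (total-cert<0 △-free) cert≥0

-- Rational weights on the vertices.

module Weights where

  open import Algebra.Properties.Semiring.Sum (CommutativeRing.semiring ℚ.+-*-commutativeRing)
    using (sum; sum-cong-≗; ∑-distrib-+; ∑-comm; *-distribˡ-sum)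
  open import Data.List.Extrema (DecTotalOrder.totalOrder ℚ.≤-decTotalOrder)
    using (argmin; argmin-all; f[argmin]≤f[xs])
  open import Data.Rational
    using (ℚ; mkℚ; 0ℚ; 1ℚ; ½; _+_; _*_; _-_; -_; _≤_; _<_; _/_; positive; nonNegative; 1/_; *≤*)
  open import Data.Rational.Solver using (module +-*-Solver)
  open +-*-Solver using (solve; _:=_; _:+_; _:*_; _:-_; :-_; con)

  2ℚ : ℚ
  2ℚ = ℤ.+ 2 / 1

  -- Written in lowest terms directly, as `i / 1` would pass through a gcd. Numerator and
  -- denominator are then visible by computation, and order and products reduce to those of ℤ.
  fromℤ : ℤ → ℚ
  fromℤ i = mkℚ i 0 (Coprime.sym (Coprime.1-coprimeTo ℤ.∣ i ∣))

  fromℕ : ℕ → ℚ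
  fromℕ n = fromℤ (ℤ.+ n)

  fromℤ-+ : ∀ i j → fromℤ (i ℤ.+ j) ≡ fromℤ i + fromℤ j
  fromℤ-+ i j = ℚ.toℚᵘ-injective (ℚᵘ.≃-trans
    (ℚᵘ.*≡* (cong (ℤ._* ℤ.+ 1) (cong₂ ℤ._+_ (sym (ℤ.*-identityʳ i)) (sym (ℤ.*-identityʳ j)))))
    (ℚᵘ.≃-sym (ℚ.toℚᵘ-homo-+ (fromℤ i) (fromℤ j))))

  fromℤ-* : ∀ i j → fromℤ (i ℤ.* j) ≡ fromℤ i * fromℤ j
  fromℤ-* i j = ℚ.toℚᵘ-injective (ℚᵘ.≃-sym (ℚ.toℚᵘ-homo-* (fromℤ i) (fromℤ j)))

  fromℤ-mono : ∀ {i j} → i ℤ.≤ j → fromℤ i ≤ fromℤ j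
  fromℤ-mono {i} {j} i≤j = *≤* (subst₂ ℤ._≤_ (sym (ℤ.*-identityʳ i)) (sym (ℤ.*-identityʳ j)) i≤j)

  fromℤ-cancel : ∀ {i j} → fromℤ i ≤ fromℤ j → i ℤ.≤ j
  fromℤ-cancel {i} {j} (*≤* i≤j) = subst₂ ℤ._≤_ (ℤ.*-identityʳ i) (ℤ.*-identityʳ j) i≤j

  0≤q-p : ∀ {p q} → p ≤ q → 0ℚ ≤ q - p
  0≤q-p {p} {q} p≤q = subst (_≤ q - p) (ℚ.+-inverseʳ p) (ℚ.+-monoˡ-≤ (- p) p≤q)

  p≤q-by : ∀ {p q} → 0ℚ ≤ q - p → p ≤ q
  p≤q-by {p} {q} 0≤ = subst₂ _≤_ (ℚ.+-identityˡ p)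
    (solve 2 (λ p q → q :- p :+ p := q) refl p q) (ℚ.+-monoˡ-≤ p 0≤)

  0≤+ : ∀ {p q} → 0ℚ ≤ p → 0ℚ ≤ q → 0ℚ ≤ p + q
  0≤+ = ℚ.+-mono-≤

  0≤* : ∀ {p q} → 0ℚ ≤ p → 0ℚ ≤ q → 0ℚ ≤ p * q
  0≤* {p} {q} 0≤p 0≤q = subst (_≤ p * q) (ℚ.*-zeroʳ p) (ℚ.*-monoˡ-≤-nonNeg p {{nonNegative 0≤p}} 0≤q)

  0<* : ∀ {p q} → 0ℚ < p → 0ℚ < q → 0ℚ < p * q
  0<* {p} {q} 0<p 0<q = subst (_< p * q) (ℚ.*-zeroʳ p) (ℚ.*-monoʳ-<-pos p {{positive 0<p}} 0<q)

  cancel-pos : ∀ {p q} → 0ℚ < p → 0ℚ ≤ p * q → 0ℚ ≤ q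
  cancel-pos {p} {q} 0<p 0≤pq = ℚ.*-cancelˡ-≤-pos p {{positive 0<p}} (subst (_≤ p * q) (sym (ℚ.*-zeroʳ p)) 0≤pq)

  0≤2 : 0ℚ ≤ 2ℚ
  0≤2 = ℚ.nonNegative⁻¹ 2ℚ

  sum-mono : ∀ {n} {f g : Fin n → ℚ} → (∀ i → f i ≤ g i) → sum f ≤ sum g
  sum-mono {zero}  f≤g = ℚ.≤-refl
  sum-mono {suc n} f≤g = ℚ.+-mono-≤ (f≤g Fin.zero) (sum-mono (f≤g ∘ Fin.suc))

  sum-zero : ∀ n → sum {n} (λ _ → 0ℚ) ≡ 0ℚ
  sum-zero zero    = refl
  sum-zero (suc n) = trans (ℚ.+-identityˡ _) (sum-zero n)

  sum-const : ∀ n c → sum {n} (λ _ → c) ≡ fromℕ n * c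
  sum-const zero    c = sym (ℚ.*-zeroˡ c)
  sum-const (suc n) c = begin
    c + sum {n} (λ _ → c)           ≡⟨ cong (c +_) (sum-const n c) ⟩
    c + fromℕ n * c             ≡⟨ solve 2 (λ c n → c :+ n :* c := (con 1ℚ :+ n) :* c) refl c (fromℕ n) ⟩
    (1ℚ + fromℕ n) * c          ≡⟨ cong (_* c) (sym (fromℤ-+ (ℤ.+ 1) (ℤ.+ n))) ⟩
    fromℕ (suc n) * c             ∎

  δ : ∀ {n} → Fin n → Fin n → ℚ
  δ i j = if does (i Fin.≟ j) then 1ℚ else 0ℚ

  δ-refl : ∀ {n} (i : Fin n) → δ i i ≡ 1ℚ
  δ-refl i with i Fin.≟ i
  ... | yes _  = refl
  ... | no i≢i = ⊥-elim (i≢i refl)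

  δ-≢ : ∀ {n} (i j : Fin n) → i ≢ j → δ i j ≡ 0ℚ
  δ-≢ i j i≢j with i Fin.≟ j
  ... | yes i≡j = ⊥-elim (i≢j i≡j)
  ... | no _    = refl

  sum-δ : ∀ {n} (i : Fin n) (f : Fin n → ℚ) → sum (λ j → δ i j * f j) ≡ f i
  sum-δ {suc n} Fin.zero f = begin
    1ℚ * f Fin.zero + sum (λ j → 0ℚ * f (Fin.suc j))
      ≡⟨ cong₂ _+_ (ℚ.*-identityˡ (f Fin.zero)) (trans (sum-cong-≗ λ j → ℚ.*-zeroˡ (f (Fin.suc j))) (sum-zero n)) ⟩
    f Fin.zero + 0ℚ ≡⟨ ℚ.+-identityʳ (f Fin.zero) ⟩
    f Fin.zero      ∎
  sum-δ {suc n} (Fin.suc i) f = begin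
    0ℚ * f Fin.zero + sum (λ j → δ (Fin.suc i) (Fin.suc j) * f (Fin.suc j))
      ≡⟨ cong₂ _+_ (ℚ.*-zeroˡ (f Fin.zero)) (sum-cong-≗ λ j → cong (_* f (Fin.suc j)) (δ-suc j)) ⟩
    0ℚ + sum (λ j → δ i j * f (Fin.suc j)) ≡⟨ ℚ.+-identityˡ _ ⟩
    sum (λ j → δ i j * f (Fin.suc j))      ≡⟨ sum-δ i (f ∘ Fin.suc) ⟩
    f (Fin.suc i) ∎
    where
    δ-suc : ∀ j → δ (Fin.suc i) (Fin.suc j) ≡ δ i j
    δ-suc j with i Fin.≟ j
    ... | yes _ = refl
    ... | no _  = refl

  bitℚ : Bool → ℚ
  bitℚ b = if b then 1ℚ else 0ℚ

  vecs : ∀ n → List (Vec Bool n)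
  vecs zero    = [] ∷ []
  vecs (suc n) = cartesianProductWith _∷_ (false ∷ true ∷ []) (vecs n)

  ∈-vecs : ∀ {n} (c : Vec Bool n) → c ∈ vecs n
  ∈-vecs []      = here refl
  ∈-vecs (b ∷ c) = ∈-cartesianProductWith⁺ _∷_ (∈-bool b) (∈-vecs c)
    where
    ∈-bool : ∀ b → b ∈ false ∷ true ∷ []
    ∈-bool false = here refl
    ∈-bool true  = there (here refl)

  -- The default `x₀` is itself among the competitors, so it has to satisfy `P` for the result to do
  -- so.
  argmin-filter : ∀ {X : Set} (f : X → ℚ) {P : X → Set} (P? : ∀ x → Dec (P x)) xs x₀ → P x₀ →
    ∃[ x ] (P x × (∀ {y} → y ∈ xs → P y → f x ≤ f y))
  argmin-filter f {P} P? xs x₀ p₀ = argmin f x₀ (filter P? xs) , argmin-all f {P = P} p₀ (All.all-filter P? xs) ,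
    λ y∈xs py → All.lookup (f[argmin]≤f[xs] x₀ (filter P? xs)) (∈-filter⁺ P? y∈xs py)

  -- Concavity of the quadratic form and rounding of halves.

  module Quadratic {n : ℕ} (A : Fin n → Fin n → Bool) (A-sym : ∀ x y → A x y ≡ A y x)
    (A-irr : ∀ x → A x x ≡ false) where

    private
      V = Fin n → ℚ

    nbr : V → V
    nbr μ u = sum λ v → bitℚ (A u v) * μ v

    Q : V → ℚ
    Q μ = sum λ u → sum λ v → bitℚ (A u v) * (μ u * μ v)

    Q-nbr : ∀ μ → Q μ ≡ sum λ u → μ u * nbr μ u
    Q-nbr μ = sum-cong-≗ λ u → trans
      (sum-cong-≗ λ v → solve 3 (λ a x y → a :* (x :* y) := x :* (a :* y)) refl (bitℚ (A u v)) (μ u) (μ v))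
      (sym (*-distribˡ-sum (μ u) (λ v → bitℚ (A u v) * μ v)))

    nbr-adjoint : ∀ μ ν → sum (λ u → μ u * nbr ν u) ≡ sum (λ u → ν u * nbr μ u)
    nbr-adjoint μ ν = begin
      sum (λ u → μ u * nbr ν u)
        ≡⟨ sum-cong-≗ (λ u → *-distribˡ-sum (μ u) (λ v → bitℚ (A u v) * ν v)) ⟩
      sum (λ u → sum λ v → μ u * (bitℚ (A u v) * ν v))
        ≡⟨ ∑-comm (λ u v → μ u * (bitℚ (A u v) * ν v)) ⟩
      sum (λ v → sum λ u → μ u * (bitℚ (A u v) * ν v))
        ≡⟨ sum-cong-≗ (λ v → sum-cong-≗ λ u → trans
             (solve 3 (λ a x y → x :* (a :* y) := y :* (a :* x)) refl (bitℚ (A u v)) (μ u) (ν v))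
             (cong (λ b → ν v * (bitℚ b * μ u)) (A-sym u v))) ⟩
      sum (λ v → sum λ u → ν v * (bitℚ (A v u) * μ u))
        ≡⟨ sum-cong-≗ (λ v → sym (*-distribˡ-sum (ν v) (λ u → bitℚ (A v u) * μ u))) ⟩
      sum (λ v → ν v * nbr μ v) ∎

    nbr-linear : ∀ μ t ν u → nbr (λ v → μ v + t * ν v) u ≡ nbr μ u + t * nbr ν u
    nbr-linear μ t ν u = begin
      sum (λ v → bitℚ (A u v) * (μ v + t * ν v))
        ≡⟨ sum-cong-≗ (λ v → solve 4 (λ a x t y → a :* (x :+ t :* y) := a :* x :+ t :* (a :* y)) refl
             (bitℚ (A u v)) (μ v) t (ν v)) ⟩
      sum (λ v → bitℚ (A u v) * μ v + t * (bitℚ (A u v) * ν v))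
        ≡⟨ ∑-distrib-+ (λ v → bitℚ (A u v) * μ v) (λ v → t * (bitℚ (A u v) * ν v)) ⟩
      nbr μ u + sum (λ v → t * (bitℚ (A u v) * ν v))
        ≡⟨ cong (nbr μ u +_) (sym (*-distribˡ-sum t (λ v → bitℚ (A u v) * ν v))) ⟩
      nbr μ u + t * nbr ν u ∎

    Q-linear : ∀ μ t ν → Q (λ v → μ v + t * ν v) ≡
      Q μ + (2ℚ * t * sum (λ u → ν u * nbr μ u) + t * t * Q ν)
    Q-linear μ t ν = begin
      Q (λ v → μ v + t * ν v)
        ≡⟨ Q-nbr (λ v → μ v + t * ν v) ⟩
      sum (λ u → (μ u + t * ν u) * nbr (λ v → μ v + t * ν v) u)
        ≡⟨ sum-cong-≗ (λ u → trans (cong ((μ u + t * ν u) *_) (nbr-linear μ t ν u))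
             (solve 5 (λ x t y p q → (x :+ t :* y) :* (p :+ t :* q)
                := x :* p :+ (t :* (x :* q) :+ (t :* (y :* p) :+ t :* t :* (y :* q)))) refl
                (μ u) t (ν u) (nbr μ u) (nbr ν u))) ⟩
      sum (λ u → μ u * nbr μ u + (t * (μ u * nbr ν u) + (t * (ν u * nbr μ u) + t * t * (ν u * nbr ν u))))
        ≡⟨ trans (∑-distrib-+ (λ u → μ u * nbr μ u) _) (cong₂ _+_ (sym (Q-nbr μ))
            (trans (∑-distrib-+ (λ u → t * (μ u * nbr ν u)) _) (cong₂ _+_
              (trans (sym (*-distribˡ-sum t (λ u → μ u * nbr ν u))) (cong (t *_) (nbr-adjoint μ ν)))
              (trans (∑-distrib-+ (λ u → t * (ν u * nbr μ u)) (λ u → t * t * (ν u * nbr ν u))) (cong₂ _+_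
                (sym (*-distribˡ-sum t (λ u → ν u * nbr μ u)))
                (trans (sym (*-distribˡ-sum (t * t) (λ u → ν u * nbr ν u))) (cong (t * t *_) (sym (Q-nbr ν))))))))) ⟩
      Q μ + (t * B + (t * B + t * t * Q ν))
        ≡⟨ solve 4 (λ q t b r → q :+ (t :* b :+ (t :* b :+ t :* t :* r))
             := q :+ (con 2ℚ :* t :* b :+ t :* t :* r)) refl (Q μ) t B (Q ν) ⟩
      Q μ + (2ℚ * t * B + t * t * Q ν) ∎
      where B = sum (λ u → ν u * nbr μ u)

    sum-diff : ∀ i j (f : V) → sum (λ u → (δ i u - δ j u) * f u) ≡ f i - f j
    sum-diff i j f = begin
      sum (λ u → (δ i u - δ j u) * f u)
        ≡⟨ sum-cong-≗ (λ u → solve 3 (λ a b x → (a :- b) :* x := a :* x :+ :- con 1ℚ :* (b :* x)) refl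
             (δ i u) (δ j u) (f u)) ⟩
      sum (λ u → δ i u * f u + - 1ℚ * (δ j u * f u))
        ≡⟨ ∑-distrib-+ (λ u → δ i u * f u) (λ u → - 1ℚ * (δ j u * f u)) ⟩
      sum (λ u → δ i u * f u) + sum (λ u → - 1ℚ * (δ j u * f u))
        ≡⟨ cong₂ _+_ (sum-δ i f) (trans (sym (*-distribˡ-sum (- 1ℚ) (λ u → δ j u * f u)))
             (cong (- 1ℚ *_) (sum-δ j f))) ⟩
      f i + - 1ℚ * f j
        ≡⟨ solve 2 (λ x y → x :+ :- con 1ℚ :* y := x :- y) refl (f i) (f j) ⟩
      f i - f j ∎

    -- Moving mass between two vertices is a concave change of Q, as A has no loops.
    Q-diff≤0 : ∀ i j → Q (λ u → δ i u - δ j u) ≤ 0ℚ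
    Q-diff≤0 i j = subst (_≤ 0ℚ) (sym eq) (neg (A i j))
      where
      nbr-diff : ∀ u → nbr (λ v → δ i v - δ j v) u ≡ bitℚ (A u i) - bitℚ (A u j)
      nbr-diff u = trans (sum-cong-≗ λ v → ℚ.*-comm (bitℚ (A u v)) (δ i v - δ j v))
        (sum-diff i j (λ v → bitℚ (A u v)))
      eq : Q (λ u → δ i u - δ j u) ≡ - 2ℚ * bitℚ (A i j)
      eq = begin
        Q (λ u → δ i u - δ j u)
          ≡⟨ Q-nbr (λ u → δ i u - δ j u) ⟩
        sum (λ u → (δ i u - δ j u) * nbr (λ v → δ i v - δ j v) u)
          ≡⟨ sum-diff i j (nbr (λ v → δ i v - δ j v)) ⟩
        nbr (λ v → δ i v - δ j v) i - nbr (λ v → δ i v - δ j v) j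
          ≡⟨ cong₂ _-_ (nbr-diff i) (nbr-diff j) ⟩
        (bitℚ (A i i) - bitℚ (A i j)) - (bitℚ (A j i) - bitℚ (A j j))
          ≡⟨ cong₂ (λ b c → (bitℚ b - bitℚ (A i j)) - (bitℚ (A j i) - bitℚ c)) (A-irr i) (A-irr j) ⟩
        (0ℚ - bitℚ (A i j)) - (bitℚ (A j i) - 0ℚ)
          ≡⟨ cong (λ b → (0ℚ - bitℚ (A i j)) - (bitℚ b - 0ℚ)) (A-sym j i) ⟩
        (0ℚ - bitℚ (A i j)) - (bitℚ (A i j) - 0ℚ)
          ≡⟨ solve 1 (λ a → (con 0ℚ :- a) :- (a :- con 0ℚ) := con (- 2ℚ) :* a) refl (bitℚ (A i j)) ⟩
        - 2ℚ * bitℚ (A i j) ∎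
      neg : ∀ b → - 2ℚ * bitℚ b ≤ 0ℚ
      neg false = ℚ.≤-refl
      neg true  = ℚ.nonPositive⁻¹ (- 2ℚ)

    record IsHalfℚ (μ : V) : Set where
      field
        0≤μ : ∀ v → 0ℚ ≤ μ v
        μ≤1 : ∀ v → μ v ≤ 1ℚ
        sumμ : sum μ ≡ fromℕ n * ½

    open IsHalfℚ

    private
      T : ℚ
      T = fromℕ n * ½

    Integral : ℚ → Set
    Integral q = q ≡ 0ℚ ⊎ q ≡ 1ℚ

    record _↘_at_,_ (μ μ′ : V) (i j : Fin n) : Set where
      field
        half    : IsHalfℚ μ′
        Q≤      : Q μ′ ≤ Q μ
        fixed   : ∀ v → v ≢ i → v ≢ j → μ′ v ≡ μ v
        rounded : Integral (μ′ i) ⊎ Integral (μ′ j)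

    move : V → ℚ → Fin n → Fin n → V
    move μ t i j v = μ v + t * (δ i v - δ j v)

    private
      δδ-i : ∀ {i j : Fin n} → i ≢ j → δ i i - δ j i ≡ 1ℚ
      δδ-i {i} {j} i≢j = cong₂ _-_ (δ-refl i) (δ-≢ j i (i≢j ∘ sym))

      δδ-j : ∀ {i j : Fin n} → i ≢ j → δ i j - δ j j ≡ - 1ℚ
      δδ-j {i} {j} i≢j = cong₂ _-_ (δ-≢ i j i≢j) (δ-refl j)

      δδ-other : ∀ {i j v : Fin n} → v ≢ i → v ≢ j → δ i v - δ j v ≡ 0ℚ
      δδ-other {i} {j} {v} v≢i v≢j = cong₂ _-_ (δ-≢ i v (v≢i ∘ sym)) (δ-≢ j v (v≢j ∘ sym))

    move-i : ∀ μ t {i j} → i ≢ j → move μ t i j i ≡ μ i + t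
    move-i μ t {i} i≢j = cong (μ i +_) (trans (cong (t *_) (δδ-i i≢j)) (ℚ.*-identityʳ t))

    move-j : ∀ μ t {i j} → i ≢ j → move μ t i j j ≡ μ j - t
    move-j μ t {i} {j} i≢j = trans (cong (λ z → μ j + t * z) (δδ-j i≢j))
      (solve 2 (λ x t → x :+ t :* con (- 1ℚ) := x :- t) refl (μ j) t)

    move-other : ∀ μ t {i j v} → v ≢ i → v ≢ j → move μ t i j v ≡ μ v
    move-other μ t {v = v} v≢i v≢j = trans (cong (λ z → μ v + t * z) (δδ-other v≢i v≢j))
      (solve 2 (λ x t → x :+ t :* con 0ℚ := x) refl (μ v) t)

    sum-move : ∀ μ t i j → sum (move μ t i j) ≡ sum μ
    sum-move μ t i j = begin
      sum (move μ t i j)                            ≡⟨ ∑-distrib-+ μ (λ v → t * (δ i v - δ j v)) ⟩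
      sum μ + sum (λ v → t * (δ i v - δ j v))       ≡⟨ cong (sum μ +_) (sum-cong-≗ λ v → ℚ.*-comm t (δ i v - δ j v)) ⟩
      sum μ + sum (λ v → (δ i v - δ j v) * t)       ≡⟨ cong (sum μ +_) (sum-diff i j (λ _ → t)) ⟩
      sum μ + (t - t)                               ≡⟨ solve 2 (λ s t → s :+ (t :- t) := s) refl (sum μ) t ⟩
      sum μ ∎

    -- Q is concave along the segment, with initial slope 2 (nbr μ i - nbr μ j).
    Q-move : ∀ μ t i j → 0ℚ ≤ t → nbr μ i ≤ nbr μ j → Q (move μ t i j) ≤ Q μ
    Q-move μ t i j 0≤t hᵢ≤hⱼ = p≤q-by (subst (0ℚ ≤_) (sym eq)
      (0≤+ (0≤* (0≤* 0≤2 0≤t) (0≤q-p hᵢ≤hⱼ)) (0≤* (0≤* 0≤t 0≤t) (0≤q-p (Q-diff≤0 i j)))))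
      where
      D = Q (λ v → δ i v - δ j v)
      eq : Q μ - Q (move μ t i j) ≡ 2ℚ * t * (nbr μ j - nbr μ i) + t * t * (0ℚ - D)
      eq = begin
        Q μ - Q (move μ t i j)
          ≡⟨ cong (λ z → Q μ - z) (trans (Q-linear μ t (λ v → δ i v - δ j v))
               (cong (λ z → Q μ + (2ℚ * t * z + t * t * D)) (sum-diff i j (nbr μ)))) ⟩
        Q μ - (Q μ + (2ℚ * t * (nbr μ i - nbr μ j) + t * t * D))
          ≡⟨ solve 5 (λ q t x y d → q :- (q :+ (con 2ℚ :* t :* (x :- y) :+ t :* t :* d))
               := con 2ℚ :* t :* (y :- x) :+ t :* t :* (con 0ℚ :- d)) refl (Q μ) t (nbr μ i) (nbr μ j) D ⟩
        2ℚ * t * (nbr μ j - nbr μ i) + t * t * (0ℚ - D) ∎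

    move-half : ∀ {μ t i j} → i ≢ j → IsHalfℚ μ → 0ℚ ≤ t → t ≤ μ j → t ≤ 1ℚ - μ i → IsHalfℚ (move μ t i j)
    move-half {μ} {t} {i} {j} i≢j hμ 0≤t t≤μⱼ t≤1-μᵢ = record
      { 0≤μ  = λ v → proj₁ (bounds v)
      ; μ≤1  = λ v → proj₂ (bounds v)
      ; sumμ = trans (sum-move μ t i j) (sumμ hμ)
      }
      where
      bounds : ∀ v → 0ℚ ≤ move μ t i j v × move μ t i j v ≤ 1ℚ
      bounds v with v Fin.≟ i | v Fin.≟ j
      ... | yes refl | _ = subst (λ z → 0ℚ ≤ z × z ≤ 1ℚ) (sym (move-i μ t i≢j))
        ( 0≤+ (0≤μ hμ i) 0≤t
        , p≤q-by (subst (0ℚ ≤_) (solve 2 (λ x t → con 1ℚ :- x :- t := con 1ℚ :- (x :+ t)) refl (μ i) t)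
            (0≤q-p t≤1-μᵢ)))
      ... | no _ | yes refl = subst (λ z → 0ℚ ≤ z × z ≤ 1ℚ) (sym (move-j μ t i≢j))
        ( 0≤q-p t≤μⱼ
        , p≤q-by (subst (0ℚ ≤_) (solve 2 (λ x t → con 1ℚ :- x :+ t := con 1ℚ :- (x :- t)) refl (μ j) t)
            (0≤+ (0≤q-p (μ≤1 hμ j)) 0≤t)))
      ... | no v≢i | no v≢j = subst (λ z → 0ℚ ≤ z × z ≤ 1ℚ) (sym (move-other μ t v≢i v≢j)) (0≤μ hμ v , μ≤1 hμ v)

    -- Mass flows from `j` to `i`, where the neighbours weigh no more, until `j` is empty or `i` is
    -- full. The amount moved is the smaller of `μ j` and `1ℚ - μ i`, which decides which of the two
    -- values becomes integral.
    round-towards : ∀ {μ i j} → i ≢ j → IsHalfℚ μ → nbr μ i ≤ nbr μ j → ∃[ μ′ ] (μ ↘ μ′ at i , j)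
    round-towards {μ} {i} {j} i≢j hμ hᵢ≤hⱼ with ℚ.≤-total (μ j) (1ℚ - μ i)
    ... | inj₁ μⱼ≤1-μᵢ = move μ (μ j) i j , record
      { half    = move-half i≢j hμ (0≤μ hμ j) ℚ.≤-refl μⱼ≤1-μᵢ
      ; Q≤      = Q-move μ (μ j) i j (0≤μ hμ j) hᵢ≤hⱼ
      ; fixed   = λ v → move-other μ (μ j)
      ; rounded = inj₂ (inj₁ (trans (move-j μ (μ j) i≢j) (ℚ.+-inverseʳ (μ j))))
      }
    ... | inj₂ 1-μᵢ≤μⱼ = move μ (1ℚ - μ i) i j , record
      { half    = move-half i≢j hμ (0≤q-p (μ≤1 hμ i)) 1-μᵢ≤μⱼ ℚ.≤-refl
      ; Q≤      = Q-move μ (1ℚ - μ i) i j (0≤q-p (μ≤1 hμ i)) hᵢ≤hⱼ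
      ; fixed   = λ v → move-other μ (1ℚ - μ i)
      ; rounded = inj₁ (inj₂ (trans (move-i μ (1ℚ - μ i) i≢j)
                    (solve 1 (λ x → x :+ (con 1ℚ :- x) := con 1ℚ) refl (μ i))))
      }

    round-two : ∀ {μ i j} → i ≢ j → IsHalfℚ μ → ∃[ μ′ ] (μ ↘ μ′ at i , j)
    round-two {μ} {i} {j} i≢j hμ with ℚ.≤-total (nbr μ i) (nbr μ j)
    ... | inj₁ hᵢ≤hⱼ = round-towards i≢j hμ hᵢ≤hⱼ
    ... | inj₂ hⱼ≤hᵢ with round-towards (i≢j ∘ sym) hμ hⱼ≤hᵢ
    ... | μ′ , s = μ′ , record
      { half = half ; Q≤ = Q≤ ; fixed = λ v v≢i v≢j → fixed v v≢j v≢i ; rounded = swap rounded }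
      where open _↘_at_,_ s

    -- Each further vertex is rounded against one pivot p, the only vertex below k that may stay
    -- fractional; if it is the pivot that becomes integral, the new vertex takes over its role.
    round-below : ∀ k → k ℕ.≤ n → Fin n → ∀ {μ} → IsHalfℚ μ →
      ∃[ μ′ ] ∃[ p ] (IsHalfℚ μ′ × Q μ′ ≤ Q μ × (∀ v → toℕ v ℕ.< k → v ≢ p → Integral (μ′ v)))
    round-below zero    _   p {μ} hμ = μ , p , hμ , ℚ.≤-refl , λ _ ()
    round-below (suc k) k<n p₀ hμ with round-below k (ℕ.<⇒≤ k<n) p₀ hμ
    ... | μ′ , p , hμ′ , Q≤ , int with fromℕ< k<n Fin.≟ p
    ... | yes i≡p = μ′ , p , hμ′ , Q≤ , λ v v<1+k v≢p →
      int v (ℕ.≤∧≢⇒< (ℕ.≤-pred v<1+k) λ v≡k →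
        v≢p (trans (Fin.toℕ-injective (trans v≡k (sym (Fin.toℕ-fromℕ< k<n)))) i≡p)) v≢p
    ... | no i≢p with round-two i≢p hμ′
    ... | μ″ , s = result rounded
      where
      open _↘_at_,_ s renaming (Q≤ to Q″≤)
      i = fromℕ< k<n
      below : ∀ v → toℕ v ℕ.< suc k → v ≢ i → toℕ v ℕ.< k
      below v v<1+k v≢i = ℕ.≤∧≢⇒< (ℕ.≤-pred v<1+k) λ v≡k →
        v≢i (Fin.toℕ-injective (trans v≡k (sym (Fin.toℕ-fromℕ< k<n))))
      result : Integral (μ″ i) ⊎ Integral (μ″ p) → _
      result (inj₁ intᵢ) = μ″ , p , half , ℚ.≤-trans Q″≤ Q≤ , int″
        where
        int″ : ∀ v → toℕ v ℕ.< suc k → v ≢ p → Integral (μ″ v)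
        int″ v v<1+k v≢p with v Fin.≟ i
        ... | yes refl = intᵢ
        ... | no v≢i   = subst Integral (sym (fixed v v≢i v≢p)) (int v (below v v<1+k v≢i) v≢p)
      result (inj₂ intₚ) = μ″ , i , half , ℚ.≤-trans Q″≤ Q≤ , int″
        where
        int″ : ∀ v → toℕ v ℕ.< suc k → v ≢ i → Integral (μ″ v)
        int″ v v<1+k v≢i with v Fin.≟ p
        ... | yes refl = intₚ
        ... | no v≢p   = subst Integral (sym (fixed v v≢i v≢p)) (int v (below v v<1+k v≢i) v≢p)

    -- Existence of a minimal rational half.

    Cand : Set
    Cand = Vec Bool n × Fin n

    -- The value at p is forced by the total weight, and may fall outside [0, 1].
    cand : Cand → V
    cand (c , p) v = bitℚ (lookup c v) + δ p v * (T - sum (λ u → bitℚ (lookup c u)))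

    -- With `b` the 0-1 vector of `c`, the difference `μ - b` is supported at `p`, so its only value
    -- is the difference of the totals, which is what `cand` adds at `p`. The bit of `c` at `p` is
    -- thereby compensated, whatever it is.
    cand-complete : ∀ {μ p} → IsHalfℚ μ → (∀ v → v ≢ p → Integral (μ v)) → ∃[ x ] (∀ v → cand x v ≡ μ v)
    cand-complete {μ} {p} hμ int = (c , p) , eq
      where
      c = tabulate (λ v → does (μ v ℚ.≟ 1ℚ))
      b : V
      b v = bitℚ (lookup c v)
      b≡μ : ∀ v → v ≢ p → b v ≡ μ v
      b≡μ v v≢p = trans (cong bitℚ (Vec.lookup∘tabulate (λ v → does (μ v ℚ.≟ 1ℚ)) v)) (go (int v v≢p))
        where
        go : Integral (μ v) → bitℚ (does (μ v ℚ.≟ 1ℚ)) ≡ μ v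
        go (inj₁ μᵥ≡0) rewrite μᵥ≡0 = refl
        go (inj₂ μᵥ≡1) rewrite μᵥ≡1 = refl
      support : ∀ v → μ v + - 1ℚ * b v ≡ δ p v * (μ v + - 1ℚ * b v)
      support v with p Fin.≟ v
      ... | yes refl = sym (ℚ.*-identityˡ (μ v + - 1ℚ * b v))
      ... | no p≢v   = trans (cong (λ z → μ v + - 1ℚ * z) (b≡μ v (p≢v ∘ sym)))
        (solve 2 (λ x y → x :+ :- con 1ℚ :* x := con 0ℚ :* y) refl (μ v) (μ v + - 1ℚ * b v))
      gap : T - sum b ≡ μ p + - 1ℚ * b p
      gap = begin
        T - sum b                              ≡⟨ cong (_- sum b) (sym (sumμ hμ)) ⟩
        sum μ - sum b                          ≡⟨ solve 2 (λ x y → x :- y := x :+ :- con 1ℚ :* y) refl (sum μ) (sum b) ⟩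
        sum μ + - 1ℚ * sum b                   ≡⟨ cong (sum μ +_) (*-distribˡ-sum (- 1ℚ) b) ⟩
        sum μ + sum (λ v → - 1ℚ * b v)         ≡⟨ sym (∑-distrib-+ μ (λ v → - 1ℚ * b v)) ⟩
        sum (λ v → μ v + - 1ℚ * b v)           ≡⟨ sum-cong-≗ support ⟩
        sum (λ v → δ p v * (μ v + - 1ℚ * b v)) ≡⟨ sum-δ p (λ v → μ v + - 1ℚ * b v) ⟩
        μ p + - 1ℚ * b p                       ∎
      eq : ∀ v → cand (c , p) v ≡ μ v
      eq v = trans (cong (b v +_) (trans (cong (δ p v *_) gap) (swap-support v)))
        (solve 2 (λ x y → y :+ (x :+ :- con 1ℚ :* y) := x) refl (μ v) (b v))
        where
        swap-support : ∀ v → δ p v * (μ p + - 1ℚ * b p) ≡ μ v + - 1ℚ * b v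
        swap-support v = trans (δ-subst v) (sym (support v))
          where
          δ-subst : ∀ v → δ p v * (μ p + - 1ℚ * b p) ≡ δ p v * (μ v + - 1ℚ * b v)
          δ-subst v with p Fin.≟ v
          ... | yes refl = refl
          ... | no _     = trans (ℚ.*-zeroˡ (μ p + - 1ℚ * b p)) (sym (ℚ.*-zeroˡ (μ v + - 1ℚ * b v)))

    Q-cong : ∀ {μ ν} → (∀ v → μ v ≡ ν v) → Q μ ≡ Q ν
    Q-cong eq = sum-cong-≗ λ u → sum-cong-≗ λ v → cong₂ (λ x y → bitℚ (A u v) * (x * y)) (eq u) (eq v)

    half-cong : ∀ {μ ν} → (∀ v → μ v ≡ ν v) → IsHalfℚ μ → IsHalfℚ ν
    half-cong eq hμ = record
      { 0≤μ  = λ v → subst (0ℚ ≤_) (eq v) (0≤μ hμ v)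
      ; μ≤1  = λ v → subst (_≤ 1ℚ) (eq v) (μ≤1 hμ v)
      ; sumμ = trans (sym (sum-cong-≗ eq)) (sumμ hμ)
      }

    isHalf? : ∀ μ → Dec (IsHalfℚ μ)
    isHalf? μ = map′ (λ (a , b , c) → record { 0≤μ = a ; μ≤1 = b ; sumμ = c })
      (λ h → 0≤μ h , μ≤1 h , sumμ h)
      (Fin.all? (λ v → 0ℚ ℚ.≤? μ v) ×-dec Fin.all? (λ v → μ v ℚ.≤? 1ℚ) ×-dec (sum μ ℚ.≟ T))

    abstract
      round : .{{_ : NonZero n}} → ∀ {μ} → IsHalfℚ μ → ∃[ x ] (IsHalfℚ (cand x) × Q (cand x) ≤ Q μ)
      round {μ} hμ = finish (round-below n ℕ.≤-refl (fromℕ< (ℕ.>-nonZero⁻¹ n)) hμ)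
        where
        finish : ∃[ μ′ ] ∃[ p ] (IsHalfℚ μ′ × Q μ′ ≤ Q μ × (∀ v → toℕ v ℕ.< n → v ≢ p → Integral (μ′ v))) →
          ∃[ x ] (IsHalfℚ (cand x) × Q (cand x) ≤ Q μ)
        finish (μ′ , p , hμ′ , Q≤ , int) =
          let x , eq = cand-complete hμ′ (λ v → int v (Fin.toℕ<n v))
          in x , half-cong (λ v → sym (eq v)) hμ′ , subst (_≤ Q μ) (sym (Q-cong eq)) Q≤

      constant-half : IsHalfℚ (λ _ → ½)
      constant-half = record
        { 0≤μ = λ _ → ℚ.nonNegative⁻¹ ½ ; μ≤1 = λ _ → ℚ.≤ᵇ⇒≤ {½} {1ℚ} _ ; sumμ = sum-const n ½ }

      minimum : .{{_ : NonZero n}} → ∃[ μ ] (IsHalfℚ μ × (∀ {ν} → IsHalfℚ ν → Q μ ≤ Q ν))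
      minimum =
        -- Rounding the constant half gives one candidate that is a half, as the default for
        -- `argmin-filter`.
        let x₀ , h₀ , _   = round constant-half
            x , hx , least = argmin-filter (λ x → Q (cand x)) (λ x → isHalf? (cand x))
                              (cartesianProduct (vecs n) (allFin n)) x₀ h₀
        in cand x , hx , λ hν →
          let (c , p) , hy , Q≤ = round hν
          in ℚ.≤-trans (least (∈-cartesianProduct⁺ (∈-vecs c) (∈-allFin p)) hy) Q≤

    -- Consequences of a lower bound `m` for all rational halves: scaling and approximation.

    Q-scale : ∀ k ν → Q (λ v → k * ν v) ≡ k * k * Q ν
    Q-scale k ν = sym (trans (*-distribˡ-sum (k * k) (λ u → sum λ v → bitℚ (A u v) * (ν u * ν v)))
      (sum-cong-≗ λ u → trans (*-distribˡ-sum (k * k) (λ v → bitℚ (A u v) * (ν u * ν v)))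
        (sum-cong-≗ λ v → solve 4 (λ k a x y → k :* k :* (a :* (x :* y)) := a :* (k :* x :* (k :* y))) refl
          k (bitℚ (A u v)) (ν u) (ν v))))

    0≤bitℚ : ∀ b → 0ℚ ≤ bitℚ b
    0≤bitℚ false = ℚ.≤-refl
    0≤bitℚ true  = ℚ.nonNegative⁻¹ 1ℚ

    sum-nonneg : ∀ {m} {f : Fin m → ℚ} → (∀ i → 0ℚ ≤ f i) → 0ℚ ≤ sum f
    sum-nonneg {m} {f} 0≤f = subst (_≤ sum f) (sum-zero m) (sum-mono 0≤f)

    Q-nonneg : ∀ {ν} → (∀ v → 0ℚ ≤ ν v) → 0ℚ ≤ Q ν
    Q-nonneg 0≤ν = sum-nonneg λ u → sum-nonneg λ v → 0≤* (0≤bitℚ (A u v)) (0≤* (0≤ν u) (0≤ν v))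

    private
      N : ℚ
      N = fromℕ n

      0≤N : 0ℚ ≤ N
      0≤N = fromℤ-mono (ℤ.+≤+ z≤n)

    module Minimal .{{_ : NonZero n}} (m : ℚ) (0≤m : 0ℚ ≤ m) (least : ∀ {ν} → IsHalfℚ ν → m ≤ Q ν) where

      private
        1≤N : 1ℚ ≤ N
        1≤N = fromℤ-mono (ℤ.+≤+ (ℕ.>-nonZero⁻¹ n))

        0<N : 0ℚ < N
        0<N = ℚ.<-≤-trans (ℚ.positive⁻¹ 1ℚ) 1≤N

      -- ν * n / (2 Σ ν) is a half.
      rescale : ∀ {ν M} → (∀ v → 0ℚ ≤ ν v) → (∀ v → ν v ≤ M) → N * M ≤ 2ℚ * sum ν →
        m * (2ℚ * sum ν * (2ℚ * sum ν)) ≤ N * N * Q ν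
      rescale {ν} {M} 0≤ν ν≤M NM≤ = helper (ℚ.<-cmp 0ℚ (sum ν))
        where
        S = sum ν
        helper : Tri (0ℚ < S) (0ℚ ≡ S) (S < 0ℚ) → m * (2ℚ * S * (2ℚ * S)) ≤ N * N * Q ν
        helper (tri> _ _ S<0) = ⊥-elim (ℚ.<-irrefl refl (ℚ.<-≤-trans S<0 (sum-nonneg 0≤ν)))
        helper (tri≈ _ 0≡S _) = subst (λ s → m * (2ℚ * s * (2ℚ * s)) ≤ N * N * Q ν) 0≡S
          (subst (_≤ N * N * Q ν) (sym (ℚ.*-zeroʳ m)) (0≤* (0≤* 0≤N 0≤N) (Q-nonneg 0≤ν)))
        helper (tri< 0<S _ _) = p≤q-by (subst (0ℚ ≤_) eq
          (0≤* (0≤* (0≤* 0≤2 0≤S) (0≤* 0≤2 0≤S)) (0≤q-p (subst (m ≤_) (Q-scale k ν) (least half)))))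
          where
          0≤S : 0ℚ ≤ S
          0≤S = ℚ.<⇒≤ 0<S
          0<2S : 0ℚ < 2ℚ * S
          0<2S = 0<* (ℚ.positive⁻¹ 2ℚ) 0<S
          2S≢0 : ℚ.NonZero (2ℚ * S)
          2S≢0 = ℚ.pos⇒nonZero (2ℚ * S) {{positive 0<2S}}
          c k : ℚ
          c = (1/ (2ℚ * S)) {{2S≢0}}
          k = N * c
          0≤c : 0ℚ ≤ c
          0≤c = ℚ.<⇒≤ (ℚ.positive⁻¹ c {{ℚ.1/pos⇒pos (2ℚ * S) {{positive 0<2S}}}})
          c2S≡1 : c * (2ℚ * S) ≡ 1ℚ
          c2S≡1 = ℚ.*-inverseˡ (2ℚ * S) {{2S≢0}}
          half : IsHalfℚ (λ v → k * ν v)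
          half = record
            { 0≤μ  = λ v → 0≤* (0≤* 0≤N 0≤c) (0≤ν v)
            ; μ≤1  = λ v → p≤q-by (subst (0ℚ ≤_) (eq₁ v) (0≤* 0≤c (0≤+ (0≤q-p NM≤) (0≤* 0≤N (0≤q-p (ν≤M v))))))
            ; sumμ = begin
                sum (λ v → k * ν v)    ≡⟨ sym (*-distribˡ-sum k ν) ⟩
                N * c * S              ≡⟨ solve 3 (λ n c s →
                  n :* c :* s := n :* (con ½ :* (c :* (con 2ℚ :* s)))) refl N c S ⟩
                N * (½ * (c * (2ℚ * S))) ≡⟨ cong (λ z → N * (½ * z)) c2S≡1 ⟩
                N * ½                  ∎
            }
            where
            eq₁ : ∀ v → c * ((2ℚ * S - N * M) + N * (M - ν v)) ≡ 1ℚ - k * ν v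
            eq₁ v = trans (solve 5 (λ c s n m x → c :* ((con 2ℚ :* s :- n :* m) :+ n :* (m :- x))
                := c :* (con 2ℚ :* s) :- n :* c :* x) refl c S N M (ν v))
              (cong (_- k * ν v) c2S≡1)
          eq : 2ℚ * S * (2ℚ * S) * (k * k * Q ν - m) ≡ N * N * Q ν - m * (2ℚ * S * (2ℚ * S))
          eq = begin
            2ℚ * S * (2ℚ * S) * (k * k * Q ν - m)
              ≡⟨ solve 5 (λ s n c q m → con 2ℚ :* s :* (con 2ℚ :* s) :* (n :* c :* (n :* c) :* q :- m)
                   := n :* n :* q :* ((c :* (con 2ℚ :* s)) :* (c :* (con 2ℚ :* s))) :- m :* (con 2ℚ :* s :* (con 2ℚ :* s)))
                   refl S N c (Q ν) m ⟩
            N * N * Q ν * ((c * (2ℚ * S)) * (c * (2ℚ * S))) - m * (2ℚ * S * (2ℚ * S))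
              ≡⟨ cong (λ z → N * N * Q ν * (z * z) - m * (2ℚ * S * (2ℚ * S))) c2S≡1 ⟩
            N * N * Q ν * 1ℚ - m * (2ℚ * S * (2ℚ * S))
              ≡⟨ cong (_- m * (2ℚ * S * (2ℚ * S))) (ℚ.*-identityʳ (N * N * Q ν)) ⟩
            N * N * Q ν - m * (2ℚ * S * (2ℚ * S)) ∎

      private
        27ℚ 128ℚ 512ℚ 12ℚ : ℚ
        27ℚ = ℤ.+ 27 / 1
        128ℚ = ℤ.+ 128 / 1
        512ℚ = ℤ.+ 512 / 1
        12ℚ = ℤ.+ 12 / 1

      -- This is (∗) over ℚ. The hypothesis says `m / (2n²) ≥ 27/1024`, since `Q` counts every edge
      -- twice. With S the sum of `ν`, `rescale` gives `4 m S² ≤ n² Q ν`; inserting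
      -- `m ≥ 27 n² / 512` and cancelling `4n²` leaves the claim.
      dense : 27ℚ * (N * N) ≤ 512ℚ * m → ∀ {ν M} → (∀ v → 0ℚ ≤ ν v) → (∀ v → ν v ≤ M) →
        N * M ≤ 2ℚ * sum ν → 0ℚ ≤ 128ℚ * Q ν - 27ℚ * (sum ν * sum ν)
      dense m-large {ν} 0≤ν ν≤M NM≤ = cancel-pos (0<* (ℚ.positive⁻¹ (ℤ.+ 4 / 1)) (0<* 0<N 0<N))
        (subst (0ℚ ≤_)
          (solve 4 (λ n m s q → let 2s = con 2ℚ :* s in
             con 512ℚ :* (n :* n :* q :- m :* (2s :* 2s)) :+ (2s :* 2s) :* (con 512ℚ :* m :- con 27ℚ :* (n :* n))
             := con (ℤ.+ 4 / 1) :* (n :* n) :* (con 128ℚ :* q :- con 27ℚ :* (s :* s))) refl N m (sum ν) (Q ν))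
          (0≤+ (0≤* (ℚ.nonNegative⁻¹ 512ℚ) (0≤q-p (rescale 0≤ν ν≤M NM≤)))
               (0≤* (0≤* 0≤2S 0≤2S) (0≤q-p m-large))))
        where
        0≤2S : 0ℚ ≤ 2ℚ * sum ν
        0≤2S = 0≤* 0≤2 (sum-nonneg 0≤ν)

      -- The shifted weight q + 2δ has values in [0, 1 + 3δ], and rescale applies to it.
      approximate : ∀ {q δ} → 0ℚ ≤ δ → δ ≤ 1ℚ → (∀ v → 0ℚ ≤ q v + δ) → (∀ v → q v ≤ 1ℚ + δ) →
        N * ½ ≤ sum q + ½ * δ → m ≤ Q q + N * (N * (12ℚ * δ))
      approximate {q} {δ} 0≤δ δ≤1 -δ≤q q≤1+δ half≤ =
        ℚ.≤-trans m≤Qν (subst (Q ν ≤_) sum-eq (sum-mono λ u → sum-mono λ v → term (A u v) u v))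
        where
        ν : V
        ν v = q v + 2ℚ * δ
        M = 1ℚ + ℤ.+ 3 / 1 * δ
        0≤ν : ∀ v → 0ℚ ≤ ν v
        0≤ν v = subst (0ℚ ≤_) (solve 2 (λ x d → x :+ d :+ d := x :+ con 2ℚ :* d) refl (q v) δ) (0≤+ (-δ≤q v) 0≤δ)
        ν≤M : ∀ v → ν v ≤ M
        ν≤M v = p≤q-by (subst (0ℚ ≤_)
          (solve 2 (λ x d → con 1ℚ :+ d :- x := con 1ℚ :+ con (ℤ.+ 3 / 1) :* d :- (x :+ con 2ℚ :* d)) refl (q v) δ)
          (0≤q-p (q≤1+δ v)))
        sum-ν : sum ν ≡ sum q + N * (2ℚ * δ)
        sum-ν = trans (∑-distrib-+ q (λ _ → 2ℚ * δ)) (cong (sum q +_) (sum-const n (2ℚ * δ)))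
        -- Here the shift has to be 2δ. A shift by δ gives the cap `1 + 2δ` and adds 2nδ to both
        -- sides, leaving nothing for the deficit δ in `2 Σ q`. With 2δ the right side gains 4nδ and
        -- the left 3nδ, and the surplus nδ covers the deficit because `n ≥ 1`.
        NM≤ : N * M ≤ 2ℚ * sum ν
        NM≤ = p≤q-by (subst (0ℚ ≤_) (trans
          (solve 3 (λ n s d → con 2ℚ :* (s :+ con ½ :* d :- n :* con ½) :+ d :* (n :- con 1ℚ)
             := con 2ℚ :* (s :+ n :* (con 2ℚ :* d)) :- n :* (con 1ℚ :+ con (ℤ.+ 3 / 1) :* d)) refl N (sum q) δ)
          (cong (λ z → 2ℚ * z - N * M) (sym sum-ν)))
          (0≤+ (0≤* 0≤2 (0≤q-p half≤)) (0≤* 0≤δ (0≤q-p 1≤N))))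
        N≤2S : N ≤ 2ℚ * sum ν
        N≤2S = ℚ.≤-trans (p≤q-by (subst (0ℚ ≤_)
          (solve 2 (λ n d → n :* (con (ℤ.+ 3 / 1) :* d) := n :* (con 1ℚ :+ con (ℤ.+ 3 / 1) :* d) :- n) refl N δ)
          (0≤* 0≤N (0≤* (ℚ.nonNegative⁻¹ (ℤ.+ 3 / 1)) 0≤δ)))) NM≤
        m≤Qν : m ≤ Q ν
        m≤Qν = p≤q-by (cancel-pos (0<* 0<N 0<N) (subst (0ℚ ≤_)
          (solve 4 (λ n m s q → (n :* n :* q :- m :* (s :* s)) :+ m :* ((s :- n) :* (s :- n) :+ con 2ℚ :* (n :* (s :- n)))
             := n :* n :* (q :- m)) refl N m (2ℚ * sum ν) (Q ν))
          (0≤+ (0≤q-p (rescale 0≤ν ν≤M NM≤))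
            (0≤* 0≤m (0≤+ (0≤* (0≤q-p N≤2S) (0≤q-p N≤2S)) (0≤* 0≤2 (0≤* 0≤N (0≤q-p N≤2S))))))))
        term : ∀ b u v → bitℚ b * (ν u * ν v) ≤ bitℚ b * (q u * q v) + 12ℚ * δ
        term false u v = p≤q-by (subst (0ℚ ≤_)
          (solve 3 (λ x y z → z := con 0ℚ :* x :+ z :- con 0ℚ :* y) refl (q u * q v) (ν u * ν v) (12ℚ * δ))
          (0≤* (ℚ.nonNegative⁻¹ 12ℚ) 0≤δ))
        -- The shift changes the product by `2δ (q u + q v) + 4δ²`, at most `4δ + 8δ²`, which is at
        -- most 12δ as `δ ≤ 1`.
        term true u v = p≤q-by (subst (0ℚ ≤_)
          (solve 3 (λ x y d → con 2ℚ :* d :* ((con 1ℚ :+ d :- x) :+ (con 1ℚ :+ d :- y) :+ con (ℤ.+ 4 / 1) :* (con 1ℚ :- d))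
             := con 1ℚ :* (x :* y) :+ con 12ℚ :* d :- con 1ℚ :* ((x :+ con 2ℚ :* d) :* (y :+ con 2ℚ :* d)))
             refl (q u) (q v) δ)
          (0≤* (0≤* 0≤2 0≤δ) (0≤+ (0≤+ (0≤q-p (q≤1+δ u)) (0≤q-p (q≤1+δ v)))
            (0≤* (ℚ.nonNegative⁻¹ (ℤ.+ 4 / 1)) (0≤q-p δ≤1)))))
        sum-eq : sum (λ u → sum λ v → bitℚ (A u v) * (q u * q v) + 12ℚ * δ) ≡ Q q + N * (N * (12ℚ * δ))
        sum-eq = trans (sum-cong-≗ λ u → ∑-distrib-+ (λ v → bitℚ (A u v) * (q u * q v)) (λ _ → 12ℚ * δ))
          (trans (∑-distrib-+ (λ u → sum λ v → bitℚ (A u v) * (q u * q v)) (λ _ → sum {n} (λ _ → 12ℚ * δ)))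
            (cong (Q q +_) (trans (sum-const n (sum {n} (λ _ → 12ℚ * δ))) (cong (N *_) (sum-const n (12ℚ * δ))))))

open import Defs
import Algebra.Properties.Semiring.Sum ℤ.+-*-semiring as ℤΣ
import Algebra.Properties.Semiring.Sum (CommutativeRing.semiring ℚ.+-*-commutativeRing) as ℚΣ
open import Data.Integer using (ℤ; +_)
open import Data.Rational using (ℚ; 0ℚ; 1ℚ; ½; _/_)
open import Data.Rational.Solver using (module +-*-Solver)
open +-*-Solver using (solve; _:=_; _:+_; _:*_; _:-_; :-_; con)
open Counting using (bit)
open Weights using (fromℤ; fromℕ; bitℚ; 0≤*; 0≤+; 0≤q-p; p≤q-by; 2ℚ)

-- Passage from rational weights to integer weights and to Cauchy sequences.

fromℤ-neg : ∀ i → fromℤ (ℤ.- i) ≡ ℚ.- fromℤ i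
fromℤ-neg (+ zero)     = refl
fromℤ-neg (+ suc n)    = refl
fromℤ-neg (ℤ.-[1+ n ]) = refl

fromℤ-sum : ∀ {n} (f : Fin n → ℤ) → fromℤ (ℤΣ.sum f) ≡ ℚΣ.sum (λ i → fromℤ (f i))
fromℤ-sum {zero}  f = refl
fromℤ-sum {suc n} f = trans (Weights.fromℤ-+ (f Fin.zero) (ℤΣ.sum (f ∘ Fin.suc)))
  (cong (ℚ._+_ (fromℤ (f Fin.zero))) (fromℤ-sum (f ∘ Fin.suc)))

n/d*d : ∀ m d .{{_ : NonZero d}} → (+ m / d) ℚ.* fromℕ d ≡ fromℕ m
n/d*d m (suc d) = ℚ.toℚᵘ-injective (ℚᵘ.≃-trans (ℚ.toℚᵘ-homo-* (+ m / suc d) (fromℕ (suc d)))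
  (ℚᵘ.≃-trans (ℚᵘ.*-congʳ {ℚ.toℚᵘ (fromℕ (suc d))} (ℚ.toℚᵘ-fromℚᵘ (ℚᵘ.mkℚᵘ (+ m) d)))
    (ℚᵘ.*≡* (trans (ℤ.*-identityʳ (+ m ℤ.* + suc d))
      (cong (λ k → + m ℤ.* + k) (sym (ℕ.*-identityʳ (suc d))))))))

n/2≡ : ∀ n → + n / 2 ≡ fromℕ n ℚ.* ½
n/2≡ n = trans (solve 1 (λ x → x := x :* con 2ℚ :* con ½) refl (+ n / 2)) (cong (ℚ._* ½) (n/d*d n 2))

-p≤∣p∣ : ∀ p → ℚ.- p ℚ.≤ ℚ.∣ p ∣
-p≤∣p∣ p with ℚ.∣p∣≡p∨∣p∣≡-p p
... | inj₂ ∣p∣≡-p = ℚ.≤-reflexive (sym ∣p∣≡-p)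
... | inj₁ ∣p∣≡p  = subst (ℚ.- p ℚ.≤_) (sym ∣p∣≡p)
  (p≤q-by (subst (0ℚ ℚ.≤_) (solve 1 (λ p → p :+ p := p :- :- p) refl p) (0≤+ 0≤p 0≤p)))
  where
  0≤p : 0ℚ ℚ.≤ p
  0≤p = subst (0ℚ ℚ.≤_) ∣p∣≡p (ℚ.0≤∣p∣ p)

∣x-y∣<e⇒y≤x+e : ∀ x y {e} → ℚ.∣ x ℚ.- y ∣ ℚ.< e → y ℚ.≤ x ℚ.+ e
∣x-y∣<e⇒y≤x+e x y {e} lt = subst₂ ℚ._≤_
  (solve 2 (λ x y → x :+ (:- (x :- y)) := y) refl x y) refl
  (ℚ.+-monoʳ-≤ x (ℚ.≤-trans (-p≤∣p∣ (x ℚ.- y)) (ℚ.<⇒≤ lt)))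

Eventually : (ℕ → Set) → Set
Eventually P = ∃[ N ] (∀ i → N ℕ.≤ i → P i)

eventually-× : ∀ {P Q} → Eventually P → Eventually Q → Eventually (λ i → P i × Q i)
eventually-× (M , p) (N , q) = M ℕ.⊔ N , λ i M⊔N≤i →
  p i (ℕ.m⊔n≤o⇒m≤o M N M⊔N≤i) , q i (ℕ.m⊔n≤o⇒n≤o M N M⊔N≤i)

eventually-∀ : ∀ {n} {P : Fin n → ℕ → Set} → (∀ v → Eventually (P v)) → Eventually (λ i → ∀ v → P v i)
eventually-∀ {zero}  ev = 0 , λ _ _ ()
eventually-∀ {suc n} {P} ev with eventually-× (ev Fin.zero) (eventually-∀ (ev ∘ Fin.suc))
... | N , p = N , λ i N≤i → λ where
  Fin.zero    → proj₁ (p i N≤i)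
  (Fin.suc v) → proj₂ (p i N≤i) v

≃-pointwise : ∀ {x y} → (∀ i → seq x i ≡ seq y i) → x ≃ y
≃-pointwise {x} {y} eq ε 0<ε = 0 , λ i _ → subst (ℚ._< ε)
  (sym (cong ℚ.∣_∣ (trans (cong (ℚ._- seq y i) (eq i)) (ℚ.+-inverseʳ (seq y i))))) 0<ε

p<q+ε : ∀ {p q ε} → p ℚ.≤ q → 0ℚ ℚ.< ε → p ℚ.< q ℚ.+ ε
p<q+ε {p} {q} {ε} p≤q 0<ε = subst (ℚ._< q ℚ.+ ε) (ℚ.+-identityʳ p) (ℚ.+-mono-≤-< p≤q 0<ε)

fromℚ-mono : ∀ {p q} → p ℚ.≤ q → fromℚ p ≤ fromℚ q
fromℚ-mono p≤q ε 0<ε = 0 , λ _ _ → p<q+ε p≤q 0<ε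

seq-sum : ∀ {n} (μ : Fin n → ℝ) i → seq (sum μ) i ≡ ℚΣ.sum (λ v → seq (μ v) i)
seq-sum {zero}  μ i = refl
seq-sum {suc n} μ i = cong (ℚ._+_ (seq (μ Fin.zero) i)) (seq-sum (μ ∘ Fin.suc) i)

module _ {n : ℕ} (G : Graph n) where

  adj : Fin n → Fin n → Bool
  adj u v = does (adj? G u v)

  adj-sym : ∀ u v → adj u v ≡ adj v u
  adj-sym u v with adj? G u v
  ... | yes uv = sym (dec-true (adj? G v u) (symm G uv))
  ... | no ¬uv = sym (dec-false (adj? G v u) (¬uv ∘ symm G))

  adj-irrefl : ∀ u → adj u u ≡ false
  adj-irrefl u = dec-false (adj? G u u) (irrefl G refl)

  adj-△-free : TriangleFree G → ∀ x y z → adj x y ∧ adj x z ∧ adj y z ≡ false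
  adj-△-free free x y z with adj? G x y | adj? G x z | adj? G y z
  ... | no _   | _      | _      = refl
  ... | yes _  | no _   | _      = refl
  ... | yes _  | yes _  | no _   = refl
  ... | yes xy | yes xz | yes yz = ⊥-elim (free x y z (xy , yz , xz))

  open Weights.Quadratic adj adj-sym adj-irrefl

  edgeTerm : (Fin n → ℚ) → Fin n → Fin n → ℚ
  edgeTerm q u v = if does (u Fin.<? v) ∧ adj u v then q u ℚ.* q v else 0ℚ

  edgeSumℚ : (Fin n → ℚ) → ℚ
  edgeSumℚ q = ℚΣ.sum λ u → ℚΣ.sum λ v → edgeTerm q u v

  seq-edgeSum : ∀ μ i → seq (edgeSum G μ) i ≡ edgeSumℚ (λ v → seq (μ v) i)
  seq-edgeSum μ i = trans (seq-sum (λ u → sum λ v → term u v) i)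
    (ℚΣ.sum-cong-≗ λ u → trans (seq-sum (term u) i) (ℚΣ.sum-cong-≗ λ v → seq-if (does (u Fin.<? v) ∧ adj u v) u v))
    where
    term : Fin n → Fin n → ℝ
    term u v = if does (u Fin.<? v) ∧ adj u v then μ u * μ v else fromℚ 0ℚ
    seq-if : ∀ b u v → seq (if b then μ u * μ v else fromℚ 0ℚ) i ≡ (if b then seq (μ u) i ℚ.* seq (μ v) i else 0ℚ)
    seq-if true  u v = refl
    seq-if false u v = refl

  -- Off the diagonal exactly one of the two orders passes the test `u < v`; on the diagonal both
  -- sides vanish, as there are no loops. Summing over all pairs shows that `Q` is twice the edge
  -- sum.
  edge-split : ∀ q u v → bitℚ (adj u v) ℚ.* (q u ℚ.* q v) ≡ edgeTerm q u v ℚ.+ edgeTerm q v u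
  edge-split q u v with Fin.<-cmp u v
  ... | tri< u<v _ v≮u = helper (adj u v) (adj v u) (dec-true (u Fin.<? v) u<v) (dec-false (v Fin.<? u) v≮u)
    where
    helper : ∀ a b {c d} → c ≡ true → d ≡ false → bitℚ a ℚ.* (q u ℚ.* q v) ≡
      (if c ∧ a then q u ℚ.* q v else 0ℚ) ℚ.+ (if d ∧ b then q v ℚ.* q u else 0ℚ)
    helper true  b refl refl = solve 1 (λ x → con 1ℚ :* x := x :+ con 0ℚ) refl (q u ℚ.* q v)
    helper false b refl refl = ℚ.*-zeroˡ (q u ℚ.* q v)
  ... | tri> u≮v _ v<u rewrite adj-sym u v =
    helper (adj v u) (dec-false (u Fin.<? v) u≮v) (dec-true (v Fin.<? u) v<u)
    where
    helper : ∀ a {c d} → c ≡ false → d ≡ true → bitℚ a ℚ.* (q u ℚ.* q v) ≡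
      (if c ∧ a then q u ℚ.* q v else 0ℚ) ℚ.+ (if d ∧ a then q v ℚ.* q u else 0ℚ)
    helper true  refl refl = solve 2 (λ x y → con 1ℚ :* (x :* y) := con 0ℚ :+ y :* x) refl (q u) (q v)
    helper false refl refl = ℚ.*-zeroˡ (q u ℚ.* q v)
  ... | tri≈ u≮u refl _ = helper (adj-irrefl u) (dec-false (u Fin.<? u) u≮u)
    where
    helper : ∀ {a c} → a ≡ false → c ≡ false → bitℚ a ℚ.* (q u ℚ.* q u) ≡
      (if c ∧ a then q u ℚ.* q u else 0ℚ) ℚ.+ (if c ∧ a then q u ℚ.* q u else 0ℚ)
    helper refl refl = ℚ.*-zeroˡ (q u ℚ.* q u)

  edgeSum-½Q : ∀ q → edgeSumℚ q ≡ ½ ℚ.* Q q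
  edgeSum-½Q q = trans (solve 1 (λ e → e := con ½ :* (e :+ e)) refl (edgeSumℚ q)) (cong (ℚ._*_ ½) (sym 2E))
    where
    2E : Q q ≡ edgeSumℚ q ℚ.+ edgeSumℚ q
    2E = trans (ℚΣ.sum-cong-≗ λ u → trans (ℚΣ.sum-cong-≗ (edge-split q u))
        (ℚΣ.∑-distrib-+ (edgeTerm q u) (λ v → edgeTerm q v u)))
      (trans (ℚΣ.∑-distrib-+ (λ u → ℚΣ.sum (edgeTerm q u)) (λ u → ℚΣ.sum λ v → edgeTerm q v u))
        (cong (ℚ._+_ (edgeSumℚ q)) (ℚΣ.∑-comm (λ u v → edgeTerm q v u))))

  fromℤ-quad : .{{_ : NonZero n}} → ∀ free (ν : Fin n → ℤ) →
    fromℤ (Counting.quad adj adj-sym free ν) ≡ Q (fromℤ ∘ ν)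
  fromℤ-quad free ν = trans (fromℤ-sum (λ u → ℤΣ.sum λ v → bit (adj u v) ℤ.* (ν u ℤ.* ν v)))
    (ℚΣ.sum-cong-≗ λ u → trans (fromℤ-sum (λ v → bit (adj u v) ℤ.* (ν u ℤ.* ν v)))
      (ℚΣ.sum-cong-≗ λ v → trans (Weights.fromℤ-* (bit (adj u v)) (ν u ℤ.* ν v))
        (cong₂ ℚ._*_ (fromℤ-bit (adj u v)) (Weights.fromℤ-* (ν u) (ν v)))))
    where
    fromℤ-bit : ∀ b → fromℤ (bit b) ≡ bitℚ b
    fromℤ-bit true  = refl
    fromℤ-bit false = refl

-- The value β(G): attainment, minimality among real halves, and the upper bound.

module _ (n : ℕ) .{{nz : NonZero n}} (G : Graph n) (free : TriangleFree G) where

  private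
    A = adj G
    open Weights.Quadratic A (adj-sym G) (adj-irrefl G)
    △-free = adj-△-free G free

    N κ : ℚ
    N = fromℕ n
    κ = (+ 1 / (n ℕ.* n)) {{ℕ.m*n≢0 n n}}

    κN²≡1 : κ ℚ.* (N ℚ.* N) ≡ 1ℚ
    κN²≡1 = trans (cong (ℚ._*_ κ) (trans (sym (Weights.fromℤ-* (+ n) (+ n))) (cong fromℤ (sym (ℤ.pos-* n n)))))
      (n/d*d 1 (n ℕ.* n) {{ℕ.m*n≢0 n n}})

    0<N² : 0ℚ ℚ.< N ℚ.* N
    0<N² = Weights.0<* 0<N 0<N
      where
      0<N : 0ℚ ℚ.< N
      0<N = ℚ.<-≤-trans (ℚ.positive⁻¹ 1ℚ) (Weights.fromℤ-mono (ℤ.+≤+ (ℕ.>-nonZero⁻¹ n)))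

    0≤κ : 0ℚ ℚ.≤ κ
    0≤κ = Weights.cancel-pos 0<N² (subst (0ℚ ℚ.≤_) (trans (sym κN²≡1) (ℚ.*-comm κ (N ℚ.* N))) (ℚ.nonNegative⁻¹ 1ℚ))

    seq-βAt : ∀ μ i → seq (βAt G μ) i ≡ κ ℚ.* (½ ℚ.* Q (λ v → seq (μ v) i))
    seq-βAt μ i = cong (ℚ._*_ κ) (trans (seq-edgeSum G μ i) (edgeSum-½Q G (λ v → seq (μ v) i)))

    module WithMinimum (μ* : Fin n → ℚ) (half* : IsHalfℚ μ*) (least : ∀ {ν} → IsHalfℚ ν → Q μ* ℚ.≤ Q ν) where

      m β : ℚ
      m = Q μ*
      β = κ ℚ.* (½ ℚ.* m)

      open Minimal m (Q-nonneg (IsHalfℚ.0≤μ half*)) (λ {ν} → least {ν})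

      attained : ∃[ μ ] (IsHalf μ × βAt G μ ≃ fromℚ β)
      attained = fromℚ ∘ μ* , record
        { nonneg = λ v → fromℚ-mono {0ℚ} {μ* v} (IsHalfℚ.0≤μ half* v)
        ; ≤one   = λ v → fromℚ-mono {μ* v} {1ℚ} (IsHalfℚ.μ≤1 half* v)
        ; total  = ≃-pointwise {sum (fromℚ ∘ μ*)} {fromℚ (+ n / 2)} λ i →
                     trans (seq-sum (fromℚ ∘ μ*) i) (trans (IsHalfℚ.sumμ half*) (sym (n/2≡ n)))
        } , ≃-pointwise {βAt G (fromℚ ∘ μ*)} {fromℚ β} (seq-βAt (fromℚ ∘ μ*))

      minimal : ∀ μ → IsHalf μ → fromℚ β ≤ βAt G μ
      minimal μ hμ ε 0<ε =
        let M , close = eventually-× (eventually-× (eventually-∀ λ v → IsHalf.nonneg hμ v δ 0<δ)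
                                                   (eventually-∀ λ v → IsHalf.≤one hμ v δ 0<δ))
                                     (IsHalf.total hμ (½ ℚ.* δ) (Weights.0<* (ℚ.positive⁻¹ ½) 0<δ))
        in M , λ i M≤i → bound i (close i M≤i)
        where
        1/7 6ℚ 12ℚ δ : ℚ
        1/7 = + 1 / 7
        6ℚ = + 6 / 1
        12ℚ = + 12 / 1
        -- The error term of `approximate`, after multiplication by `κ · ½`, is
        -- `κ · ½ · n² · 12δ = 6δ`; with `δ ≤ ε/7` it is strictly below ε. The cap 1 is the
        -- condition `δ ≤ 1` of `approximate`.
        δ = 1/7 ℚ.* ε ℚ.⊓ 1ℚ
        0<ε/7 : 0ℚ ℚ.< 1/7 ℚ.* ε
        0<ε/7 = Weights.0<* (ℚ.positive⁻¹ 1/7) 0<ε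
        0<δ : 0ℚ ℚ.< δ
        0<δ with ℚ.⊓-sel (1/7 ℚ.* ε) 1ℚ
        ... | inj₁ eq = subst (0ℚ ℚ.<_) (sym eq) 0<ε/7
        ... | inj₂ eq = subst (0ℚ ℚ.<_) (sym eq) (ℚ.positive⁻¹ 1ℚ)
        6δ<ε : 6ℚ ℚ.* δ ℚ.< ε
        6δ<ε = ℚ.≤-<-trans (ℚ.*-monoˡ-≤-nonNeg 6ℚ (ℚ.p⊓q≤p (1/7 ℚ.* ε) 1ℚ))
          (subst₂ ℚ._<_ (solve 1 (λ e → con 0ℚ :+ con 6ℚ :* (con 1/7 :* e) := con 6ℚ :* (con 1/7 :* e)) refl ε)
            (solve 1 (λ e → con 1/7 :* e :+ con 6ℚ :* (con 1/7 :* e) := e) refl ε)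
            (ℚ.+-monoˡ-< (6ℚ ℚ.* (1/7 ℚ.* ε)) 0<ε/7))

        bound : ∀ i → ((∀ v → 0ℚ ℚ.< seq (μ v) i ℚ.+ δ) × (∀ v → seq (μ v) i ℚ.< 1ℚ ℚ.+ δ))
                      × ℚ.∣ seq (sum μ) i ℚ.- + n / 2 ∣ ℚ.< ½ ℚ.* δ →
          β ℚ.< seq (βAt G μ) i ℚ.+ ε
        bound i ((-δ<q , q<1+δ) , sum-close) = ℚ.≤-<-trans
          (subst (β ℚ.≤_) split (ℚ.*-monoˡ-≤-nonNeg κ {{ℚ.nonNegative 0≤κ}} (ℚ.*-monoˡ-≤-nonNeg ½ m≤)))
          (subst (κ ℚ.* (½ ℚ.* Q q) ℚ.+ 6ℚ ℚ.* δ ℚ.<_) (cong (ℚ._+ ε) (sym (seq-βAt μ i)))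
            (ℚ.+-monoʳ-< (κ ℚ.* (½ ℚ.* Q q)) 6δ<ε))
          where
          q : Fin n → ℚ
          q v = seq (μ v) i
          m≤ : m ℚ.≤ Q q ℚ.+ N ℚ.* (N ℚ.* (12ℚ ℚ.* δ))
          m≤ = approximate (ℚ.<⇒≤ 0<δ) (ℚ.p⊓q≤q (1/7 ℚ.* ε) 1ℚ) (λ v → ℚ.<⇒≤ (-δ<q v)) (λ v → ℚ.<⇒≤ (q<1+δ v))
            (subst₂ (λ a b → a ℚ.≤ b ℚ.+ ½ ℚ.* δ) (n/2≡ n) (seq-sum μ i)
              (∣x-y∣<e⇒y≤x+e (seq (sum μ) i) (+ n / 2) sum-close))
          split : κ ℚ.* (½ ℚ.* (Q q ℚ.+ N ℚ.* (N ℚ.* (12ℚ ℚ.* δ)))) ≡ κ ℚ.* (½ ℚ.* Q q) ℚ.+ 6ℚ ℚ.* δ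
          split = trans
            (solve 4 (λ k x n d → k :* (con ½ :* (x :+ n :* (n :* (con 12ℚ :* d))))
               := k :* (con ½ :* x) :+ con 6ℚ :* d :* (k :* (n :* n))) refl κ (Q q) N δ)
            (cong (ℚ._+_ (κ ℚ.* (½ ℚ.* Q q))) (trans (cong (ℚ._*_ (6ℚ ℚ.* δ)) κN²≡1) (ℚ.*-identityʳ (6ℚ ℚ.* δ))))

      27≤512m : + 27 / 1024 ℚ.< β → + 27 / 1 ℚ.* (N ℚ.* N) ℚ.≤ + 512 / 1 ℚ.* m
      27≤512m lt = subst₂ ℚ._≤_
        (solve 1 (λ x → con (+ 1024 / 1) :* x :* con (+ 27 / 1024) := con (+ 27 / 1) :* x) refl (N ℚ.* N))
        (trans (solve 3 (λ x k m → con (+ 1024 / 1) :* x :* (k :* (con ½ :* m)) := con (+ 512 / 1) :* m :* (k :* x))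
                  refl (N ℚ.* N) κ m)
          (trans (cong (ℚ._*_ (+ 512 / 1 ℚ.* m)) κN²≡1) (ℚ.*-identityʳ (+ 512 / 1 ℚ.* m))))
        (ℚ.*-monoˡ-≤-nonNeg (+ 1024 / 1 ℚ.* (N ℚ.* N))
          {{ℚ.nonNegative (0≤* (ℚ.nonNegative⁻¹ (+ 1024 / 1)) (ℚ.<⇒≤ 0<N²))}} (ℚ.<⇒≤ lt))

      -- The weightings used in the removal inequality have integer values, since (2r, h) clears the
      -- denominator of the ratio h / 2r. So (∗) can be handed over in ℤ, where the certificate is
      -- evaluated.
      denseℤ : + 27 / 1024 ℚ.< β → ∀ ν M → (∀ v → ℤ.0ℤ ℤ.≤ ν v) → (∀ v → ν v ℤ.≤ M) →
        + n ℤ.* M ℤ.≤ + 2 ℤ.* ℤΣ.sum ν →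
        ℤ.0ℤ ℤ.≤ + 128 ℤ.* Counting.quad A (adj-sym G) △-free ν ℤ.- + 27 ℤ.* (ℤΣ.sum ν ℤ.* ℤΣ.sum ν)
      denseℤ lt ν M 0≤ν ν≤M nM≤ = Weights.fromℤ-cancel (subst (0ℚ ℚ.≤_) (sym eq)
        (dense (27≤512m lt) {fromℤ ∘ ν} {fromℤ M} (λ v → Weights.fromℤ-mono (0≤ν v)) (λ v → Weights.fromℤ-mono (ν≤M v))
          (subst₂ ℚ._≤_ (Weights.fromℤ-* (+ n) M)
            (trans (Weights.fromℤ-* (+ 2) (ℤΣ.sum ν)) (cong (ℚ._*_ 2ℚ) (fromℤ-sum ν))) (Weights.fromℤ-mono nM≤))))
        where
        q = Counting.quad A (adj-sym G) △-free ν
        s = ℤΣ.sum ν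
        eq : fromℤ (+ 128 ℤ.* q ℤ.- + 27 ℤ.* (s ℤ.* s)) ≡
             + 128 / 1 ℚ.* Q (fromℤ ∘ ν) ℚ.- + 27 / 1 ℚ.* (ℚΣ.sum (fromℤ ∘ ν) ℚ.* ℚΣ.sum (fromℤ ∘ ν))
        eq = trans (Weights.fromℤ-+ (+ 128 ℤ.* q) (ℤ.- (+ 27 ℤ.* (s ℤ.* s)))) (cong₂ ℚ._+_
          (trans (Weights.fromℤ-* (+ 128) q) (cong (ℚ._*_ (+ 128 / 1)) (fromℤ-quad G △-free ν)))
          (trans (fromℤ-neg (+ 27 ℤ.* (s ℤ.* s))) (cong ℚ.-_
            (trans (Weights.fromℤ-* (+ 27) (s ℤ.* s)) (cong (ℚ._*_ (+ 27 / 1))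
              (trans (Weights.fromℤ-* s s) (cong₂ ℚ._*_ (fromℤ-sum ν) (fromℤ-sum ν))))))))

      -- The minimum is attained at a rational half, so `β` is rational and its comparison with
      -- 27/1024 is decidable; this makes the argument by contradiction constructive.
      β≤27/1024 : β ℚ.≤ + 27 / 1024
      β≤27/1024 = ℚ.≮⇒≥ λ lt → Counting.not-dense A (adj-sym G) △-free (denseℤ lt)

  β-exists : ∃[ b ] (Isβ G b × b ≤ fromℚ (+ 27 / 1024))
  β-exists =
    let μ* , half* , least = minimum
        open WithMinimum μ* half* least
    in fromℚ β , record { attained = attained ; minimal = minimal } , fromℚ-mono {β} {+ 27 / 1024} β≤27/1024

theorem3p2 : (n : ℕ) .{{_ : NonZero n}} (G : Graph n) → TriangleFree G →
    ∃[ b ] (Isβ G b × b ≤ fromℚ (+ 27 / 1024))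
theorem3p2 n G free = β-exists n G free
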